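{- Let $n\ge 2$ and let $W$ be the Coxeter group of type $C_n$ with generators $S=\{s_1,\ldots,s_n\}$, whose Coxeter graph $\Gamma_{C_n}$ is the path $s_1 - s_2 - \cdots - s_n$. Let $v\in W$, and partition the vertex set of the induced subgraph $\Gamma_{C_n}[S\setminus\mathrm{Des}(v)]$ into its connected components $b_1,\ldots,b_k$. Then the number of Boolean intervals $[v,w]$ in the right weak order of $W$ with minimal element $v$ and arbitrary maximal element $w$ (including $w=v$) equals $$\prod_{i=1}^k F_{|b_i|+2},$$ where $F_\ell$ is the $\ell$-th Fibonacci number with $F_1=F_2=1$ (an empty product is $1$).
   Context: Type $C_n$: Coxeter matrix $m(s_i,s_i)=1$, $m(s_i,s_{i+1})=3$ for $1\le i\le n-2$, $m(s_{n-1},s_n)=4$, and $m(s_i,s_j)=2$ if $|i-j|>1$. Equivalently, $C_n$ is realized as the group of permutations $\pi\in\mathfrak S_{2n}$ with $\pi_i=k$ iff $\pi_{2n-i+1}=2n-k+1$, where $s_i$ ($i\in[n]$) is in $\mathrm{Des}(v)$ iff $\pi_i>\pi_{i+1}$. The right weak order: $u\le w$ iff $\ell(w)=\ell(u)+\ell(u^{ -1}w)$. $\mathrm{Des}(v)=\{s\in S:\ell(vs)<\ell(v)\}$. An interval is Boolean if it is isomorphic to the lattice of subsets of a finite set. -}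

module Defs where

open import Data.Nat using (ℕ; zero; suc; _+_; _*_; _∸_; _≤_; _<_; _≡ᵇ_; _<ᵇ_)
open import Data.Bool using (Bool; true; false; if_then_else_; _∨_)
open import Data.Fin using (Fin; zero; suc; toℕ)
open import Data.Fin.Subset using (Subset; _∈_; _⊆_; ∣_∣)
open import Data.Vec using (Vec; []; _∷_; lookup; tabulate; allFin)
open import Data.List using (List; []; _∷_; length)
open import Data.Product using (Σ; _×_; _,_; ∃)
open import Relation.Nullary using (¬_)
open import Relation.Binary.PropositionalEquality using (_≡_)

fib : ℕ → ℕ
fib zero = zero
fib (suc zero) = suc zero
fib (suc (suc k)) = fib k + fib (suc k)

-- Permutations of Fin m in one-line notation: π = (π 0, …, π (m-1)).

Perm : ℕ → Set
Perm m = Vec (Fin m) m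

_·_ : {m : ℕ} → Perm m → Perm m → Perm m
u · x = tabulate (λ i → lookup u (lookup x i))

idP : {m : ℕ} → Perm m
idP = allFin _

-- the transposition of (0-indexed) positions a and a+1 (identity if a+1 ≥ m)
adjSwap : {m : ℕ} → ℕ → Fin m → Fin m
adjSwap {suc (suc m)} zero zero = suc zero
adjSwap {suc (suc m)} zero (suc zero) = zero
adjSwap {suc (suc m)} zero (suc (suc p)) = suc (suc p)
adjSwap {suc zero} zero zero = zero
adjSwap {suc m} (suc a) zero = zero
adjSwap {suc m} (suc a) (suc p) = suc (adjSwap a p)

-- Type C_n realised inside S_{2n}.  Generator s_{a+1} (a = toℕ i, i : Fin n):
--  * for a+1 < n: swaps positions a+1,a+2 and 2n-a-1,2n-a (1-indexed);
--  * for a+1 = n: swaps positions n, n+1 (1-indexed).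
-- Right multiplication π ↦ π · s acts on positions.

gen : (n : ℕ) → Fin n → Perm (2 * n)
gen n i = tabulate (λ p → if suc (toℕ i) <ᵇ n
                            then adjSwap (toℕ i) (adjSwap (2 * n ∸ 2 ∸ toℕ i) p)
                            else adjSwap (toℕ i) p)

wordPerm : (n : ℕ) → List (Fin n) → Perm (2 * n)
wordPerm n [] = idP
wordPerm n (i ∷ ws) = gen n i · wordPerm n ws

InW : (n : ℕ) → Perm (2 * n) → Set
InW n π = ∃ λ (ws : List (Fin n)) → wordPerm n ws ≡ π

Len : (n : ℕ) → Perm (2 * n) → ℕ → Set
Len n π k = (∃ λ (ws : List (Fin n)) → length ws ≡ k × wordPerm n ws ≡ π)
          × (∀ (ws : List (Fin n)) → wordPerm n ws ≡ π → k ≤ length ws)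

-- right weak order: u ≤ w iff ℓ(w) = ℓ(u) + ℓ(u⁻¹ w)   (x = u⁻¹ w)
WLe : (n : ℕ) → Perm (2 * n) → Perm (2 * n) → Set
WLe n u w = Σ (Perm (2 * n)) λ x → u · x ≡ w ×
            Σ ℕ λ lu → Σ ℕ λ lx → Σ ℕ λ lw →
              Len n u lu × Len n x lx × Len n w lw × lw ≡ lu + lx

Des : (n : ℕ) → Perm (2 * n) → Fin n → Set
Des n v i = Σ ℕ λ k → Σ ℕ λ k' → Len n v k × Len n (v · gen n i) k' × k' < k

InInterval : (n : ℕ) → Perm (2 * n) → Perm (2 * n) → Perm (2 * n) → Set
InInterval n v w u = WLe n v u × WLe n u w

IsBooleanInterval : (n : ℕ) → Perm (2 * n) → Perm (2 * n) → Set
IsBooleanInterval n v w =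
  WLe n v w ×
  Σ ℕ λ m → Σ (Perm (2 * n) → Subset m) λ f → Σ (Subset m → Perm (2 * n)) λ g →
    (∀ S → InInterval n v w (g S)) ×
    (∀ S → f (g S) ≡ S) ×
    (∀ u → InInterval n v w u → g (f u) ≡ u) ×
    (∀ u u' → InInterval n v w u → InInterval n v w u' →
       (WLe n u u' → f u ⊆ f u') × (f u ⊆ f u' → WLe n u u'))

-- Coxeter matrix of C_n (0-indexed: vertex a is s_{a+1}) and Coxeter graph

coxℕ : ℕ → ℕ → ℕ → ℕ
coxℕ n a b =
  if a ≡ᵇ b then 1
  else if (suc a ≡ᵇ b) ∨ (suc b ≡ᵇ a)
       then (if (a + b + 3) ≡ᵇ (2 * n) then 4 else 3)
       else 2

cox : (n : ℕ) → Fin n → Fin n → ℕ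
cox n i j = coxℕ n (toℕ i) (toℕ j)

Edge : (n : ℕ) → Fin n → Fin n → Set
Edge n i j = 3 ≤ cox n i j

data Walk (n : ℕ) (B : Subset n) : Fin n → Fin n → Set where
  here : ∀ {x} → x ∈ B → Walk n B x x
  step : ∀ {x z y} → x ∈ B → Edge n x z → Walk n B z y → Walk n B x y

Connected : (n : ℕ) → Subset n → Set
Connected n B = ∀ x y → x ∈ B → y ∈ B → Walk n B x y

IsComponents : (n : ℕ) → (A : Fin n → Set) → (k : ℕ) → Vec (Subset n) k → Set
IsComponents n A k bs =
  (∀ i → A i → ∃ λ j → i ∈ lookup bs j) ×
  (∀ i j j' → i ∈ lookup bs j → i ∈ lookup bs j' → j ≡ j') ×
  (∀ j i → i ∈ lookup bs j → A i) ×
  (∀ j → ∃ λ i → i ∈ lookup bs j) ×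
  (∀ j → Connected n (lookup bs j)) ×
  (∀ j j' x y → x ∈ lookup bs j → y ∈ lookup bs j' → Edge n x y → j ≡ j')

prodFib : {n k : ℕ} → Vec (Subset n) k → ℕ
prodFib [] = 1
prodFib (b ∷ bs) = fib (∣ b ∣ + 2) * prodFib bs

{-# OPTIONS --safe #-}
-- An interval [v, w] is Boolean exactly when w = v·w_T for a set T of pairwise commuting ascents of v,
-- where w_T is the product of T. If w = v·w_T, every element between has the form v·w_K with K ⊆ T,
-- because a shortest word for w_T uses each letter of T once. Conversely, the atoms of a Boolean
-- interval of rank m are v·t for m distinct letters t; each of them occurs in every reduced word of
-- x = v⁻¹w, whose length is at most m, so each occurs once. Two adjacent letters s_i, s_{i+1} cannot both
-- start such a word, as the resulting images of {1, …, i} and {1, …, i+1} under x would not be nested.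
-- Sets of pairwise commuting ascents are the independent sets of a disjoint union of paths, and a
-- path with b vertices has F_{b+2} of them.
module Submission where

open import Defs
open import Data.Bool using (Bool; true; false; if_then_else_)
open import Data.Bool.Properties using (T-≡)
open import Data.Nat using (ℕ; zero; suc; _+_; _*_; _∸_; _≤_; _<_; z≤n; s≤s; s≤s⁻¹; _≡ᵇ_; _<ᵇ_)
open import Data.Nat.Properties
open import Data.Nat.Solver using (module +-*-Solver)
open import Data.Fin using (Fin; zero; suc; toℕ; fromℕ<; opposite)
open import Data.Fin.Properties using (toℕ-injective; toℕ<n; toℕ-fromℕ<; opposite-prop; opposite-involutive; any?)
  renaming (_≟_ to _≟F_)
open import Data.Fin.Subset using (Subset; inside; outside; _∈_; _⊆_; ∣_∣; _∪_; ⊥; ⁅_⁆)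
open import Data.Fin.Subset.Properties
  using (_∈?_; drop-there; drop-∷-⊆; out⊆; ∪-comm; ∉⊥; ∣⊥∣≡0; ∣p∣≤n; p⊆q⇒∣p∣≤∣q∣; Empty-unique; x∈p∪q⁻; x∈p∪q⁺;
         ⊆-antisym; x∈⁅x⁆; x∈⁅y⁆⇒x≡y)
open import Data.Vec using (Vec; []; _∷_; lookup; tabulate; here; there)
open import Data.Vec.Properties
  using (∷-injectiveʳ; lookup∘tabulate; tabulate∘lookup; tabulate-cong; lookup-allFin; []=⇒lookup; lookup⇒[]=)
open import Data.List using (List; []; _∷_; length; map; _++_; reverse; filter; allFin)
import Data.List as List
open import Data.List.Properties
  using (length-map; length-++; length-tabulate; length-reverse; unfold-reverse; reverse-involutive; ++-identityʳ; ++-assoc)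
open import Data.List.Membership.Propositional using () renaming (_∈_ to _∈ₗ_; _∉_ to _∉ₗ_)
open import Data.List.Membership.Propositional.Properties
  using (∈-map⁺; ∈-map⁻; ∈-++⁺ˡ; ∈-++⁺ʳ; ∈-++⁻; ∈-filter⁺; ∈-filter⁻; ∈-allFin; ∈-∃++; ∈-lookup; ∈-tabulate⁻)
import Data.List.Membership.DecPropositional as DecMembership
open import Data.List.Relation.Unary.Any using (here; there; index)
open import Data.List.Relation.Unary.Any.Properties using (lookup-index; reverse⁻)
open import Data.List.Relation.Unary.All as All using ([]; _∷_)
import Data.List.Relation.Unary.All.Properties as All
open import Data.List.Relation.Unary.AllPairs using ([]; _∷_)
open import Data.List.Relation.Unary.Unique.Propositional using (Unique)
open import Data.List.Relation.Unary.Unique.Propositional.Properties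
  using (map⁺; ++⁺; filter⁺; allFin⁺; tabulate⁺; Unique[x∷xs]⇒x∉xs)
open import Data.List.Relation.Binary.Permutation.Propositional
  using (_↭_; prep; swap; ↭-sym; ↭-trans; ↭-refl; ↭-reflexive; ↭⇒↭ₛ)
import Data.List.Relation.Binary.Permutation.Propositional as Perm
open import Data.List.Relation.Binary.Permutation.Propositional.Properties using (∈-resp-↭; ↭-length; shift)
import Data.List.Relation.Binary.Permutation.Setoid.Properties as PermSetoid
open import Data.Product using (Σ; ∃; _×_; _,_; proj₁; proj₂)
open import Data.Sum using (_⊎_; inj₁; inj₂; [_,_]′)
open import Data.Empty using (⊥-elim)
open import Function using (_∘_; id; Equivalence)
open import Relation.Nullary using (¬_; Dec; yes; no; contradiction; does)
open import Relation.Nullary.Decidable using (dec-true; toSum)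
open import Relation.Unary using (Decidable)
open import Relation.Binary.Definitions using (tri<; tri≈; tri>)
open import Relation.Binary.PropositionalEquality

-- The definitions take length as a minimum over words, so the weak order cannot be handled before
-- length has a closed formula; the statistic `M` supplies one. Facts about which letters a word
-- must contain, usually drawn from the exchange condition or the word property, come here from a
-- single invariant: every generator other than `gen n i` maps the positions {0, ..., i} to
-- themselves. A word without the letter `i` therefore preserves this segment, while a word with
-- exactly one `i` moves some position out of it. This detects letters, tells products of different
-- sets apart, and rules out adjacent initial letters. The definition of a Boolean interval does not
-- relate its rank m to lengths. One inequality comes from a strict chain of subsets along a
-- geodesic, the other from the distinct letters of the m atoms.

private
  variable
    A X : Set
    k m : ℕ

-- Independent sets of a path

Independent : ∀ {n} → Subset n → Set
Independent T = ∀ {i j} → i ∈ T → j ∈ T → toℕ j ≢ suc (toℕ i)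

AvoidsZero : ∀ {n} → Subset n → Set
AvoidsZero T = ∀ {i} → i ∈ T → toℕ i ≢ 0

-- The flag records whether the vertex preceding the first one is already chosen.
indep : ∀ {n} → Bool → Subset n → List (Subset n)
indep c     []            = [] ∷ []
indep c     (outside ∷ A) = map (outside ∷_) (indep false A)
indep true  (inside ∷ A)  = map (outside ∷_) (indep false A)
indep false (inside ∷ A)  = map (outside ∷_) (indep false A) ++ map (inside ∷_) (indep true A)

indep-unique : ∀ {n} c (A : Subset n) → Unique (indep c A)
indep-unique c     []            = [] ∷ []
indep-unique c     (outside ∷ A) = map⁺ ∷-injectiveʳ (indep-unique false A)
indep-unique true  (inside ∷ A)  = map⁺ ∷-injectiveʳ (indep-unique false A)
indep-unique false (inside ∷ A)  =
  ++⁺ (map⁺ ∷-injectiveʳ (indep-unique false A)) (map⁺ ∷-injectiveʳ (indep-unique true A)) disjoint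
  where
  disjoint : ∀ {T} → T ∈ₗ map (outside ∷_) (indep false A) × T ∈ₗ map (inside ∷_) (indep true A) → _
  disjoint (p , q) with ∈-map⁻ (outside ∷_) p | ∈-map⁻ (inside ∷_) q
  ... | _ , _ , refl | _ , _ , ()

independent-tail : ∀ {n s} {T : Subset n} → Independent (s ∷ T) → Independent T
independent-tail ind i∈T j∈T eq = ind (there i∈T) (there j∈T) (cong suc eq)

independent-head : ∀ {n} {T : Subset n} → Independent (inside ∷ T) → AvoidsZero T
independent-head ind i∈T eq = ind here (there i∈T) (cong suc eq)

∈-indep⁺ : ∀ {n} c {A T : Subset n} → T ⊆ A → Independent T → (c ≡ true → AvoidsZero T) → T ∈ₗ indep c A
∈-indep⁺ c {[]} {[]} _ _ _ = here refl
∈-indep⁺ c {outside ∷ A} {outside ∷ T} T⊆A ind az =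
  ∈-map⁺ _ (∈-indep⁺ false (drop-∷-⊆ T⊆A) (independent-tail ind) λ ())
∈-indep⁺ c {outside ∷ A} {inside ∷ T} T⊆A ind az with () ← T⊆A here
∈-indep⁺ true {inside ∷ A} {outside ∷ T} T⊆A ind az =
  ∈-map⁺ _ (∈-indep⁺ false (drop-∷-⊆ T⊆A) (independent-tail ind) λ ())
∈-indep⁺ true {inside ∷ A} {inside ∷ T} T⊆A ind az = contradiction refl (az refl here)
∈-indep⁺ false {inside ∷ A} {outside ∷ T} T⊆A ind az =
  ∈-++⁺ˡ (∈-map⁺ _ (∈-indep⁺ false (drop-∷-⊆ T⊆A) (independent-tail ind) λ ()))
∈-indep⁺ false {inside ∷ A} {inside ∷ T} T⊆A ind az =
  ∈-++⁺ʳ _ (∈-map⁺ _ (∈-indep⁺ true (drop-∷-⊆ T⊆A) (independent-tail ind) λ _ → independent-head ind))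

Indep⁻ : ∀ {n} → Bool → Subset n → Subset n → Set
Indep⁻ c A T = T ⊆ A × Independent T × (c ≡ true → AvoidsZero T)

indep⁻-outside : ∀ {n c s} {A T : Subset n} → Indep⁻ false A T → Indep⁻ c (s ∷ A) (outside ∷ T)
indep⁻-outside (T⊆A , ind , _) =
  (λ { (there i∈T) → there (T⊆A i∈T) }) ,
  (λ { (there i∈T) (there j∈T) eq → ind i∈T j∈T (suc-injective eq) }) ,
  (λ { _ (there i∈T) () })

indep⁻-inside : ∀ {n} {A T : Subset n} → Indep⁻ true A T → Indep⁻ false (inside ∷ A) (inside ∷ T)
indep⁻-inside (T⊆A , ind , az) =
  (λ { here → here ; (there i∈T) → there (T⊆A i∈T) }) ,
  (λ { here here () ; here (there j∈T) eq → az refl j∈T (suc-injective eq)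
     ; (there _) here ()
     ; (there i∈T) (there j∈T) eq → ind i∈T j∈T (suc-injective eq) }) ,
  (λ ())

∈-indep⁻ : ∀ {n} c {A T : Subset n} → T ∈ₗ indep c A → Indep⁻ c A T
∈-indep⁻ c {[]} {[]} _ = (λ ()) , (λ ()) , (λ { _ () })
∈-indep⁻ c {outside ∷ A} T∈ with _ , T∈′ , refl ← ∈-map⁻ (outside ∷_) T∈ =
  indep⁻-outside (∈-indep⁻ false T∈′)
∈-indep⁻ true {inside ∷ A} T∈ with _ , T∈′ , refl ← ∈-map⁻ (outside ∷_) T∈ =
  indep⁻-outside (∈-indep⁻ false T∈′)
∈-indep⁻ false {inside ∷ A} T∈ with ∈-++⁻ (map (outside ∷_) (indep false A)) T∈
... | inj₁ T∈₁ with _ , T∈′ , refl ← ∈-map⁻ (outside ∷_) T∈₁ = indep⁻-outside (∈-indep⁻ false T∈′)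
... | inj₂ T∈₂ with _ , T∈′ , refl ← ∈-map⁻ (inside ∷_) T∈₂ = indep⁻-inside (∈-indep⁻ true T∈′)

#indep : ∀ {n} → Bool → Subset n → ℕ
#indep c A = length (indep c A)

#indep-outside : ∀ {n} c (A : Subset n) → #indep c (outside ∷ A) ≡ #indep false A
#indep-outside c A = length-map (outside ∷_) (indep false A)

#indep-blocked : ∀ {n} (A : Subset n) → #indep true (inside ∷ A) ≡ #indep false A
#indep-blocked A = length-map (outside ∷_) (indep false A)

#indep-inside : ∀ {n} (A : Subset n) → #indep false (inside ∷ A) ≡ #indep false A + #indep true A
#indep-inside A = trans (length-++ (map (outside ∷_) (indep false A)))
  (cong₂ _+_ (length-map _ (indep false A)) (length-map _ (indep true A)))

#indep-⊥ : ∀ n → #indep false (⊥ {n}) ≡ 1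
#indep-⊥ zero    = refl
#indep-⊥ (suc n) = trans (#indep-outside false (⊥ {n})) (#indep-⊥ n)

-- Independent sets of a union of separated sets

Separated : ∀ {n} → Subset n → Subset n → Set
Separated A B = ∀ {i j} → i ∈ A → j ∈ B → i ≢ j × toℕ j ≢ suc (toℕ i) × toℕ i ≢ suc (toℕ j)

separated-sym : ∀ {n} {A B : Subset n} → Separated A B → Separated B A
separated-sym sep j∈B i∈A with i≢j , p , q ← sep i∈A j∈B = (i≢j ∘ sym) , q , p

separated-tail : ∀ {n s t} {A B : Subset n} → Separated (s ∷ A) (t ∷ B) → Separated A B
separated-tail sep i∈A j∈B with i≢j , p , q ← sep (there i∈A) (there j∈B) =
  (λ { refl → i≢j refl }) , (p ∘ cong suc) , (q ∘ cong suc)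

separated-head : ∀ {n t} {A B : Subset n} → Separated (inside ∷ A) (t ∷ B) → AvoidsZero B
separated-head sep j∈B eq = proj₁ (proj₂ (sep here (there j∈B))) (cong suc eq)

#indep-∪ : ∀ {n} (A B : Subset n) → Separated A B →
           #indep false (A ∪ B) ≡ #indep false A * #indep false B
-- Once a vertex of `A` is chosen, its successor is blocked. Separation keeps that successor out of
-- `B`, so the flag affects the factor of `A` alone.
#indep-∪-blocked : ∀ {n} (A B : Subset n) → Separated A B → AvoidsZero B →
                   #indep true (A ∪ B) ≡ #indep true A * #indep false B

#indep-∪-inside : ∀ {n} (A B : Subset n) → Separated (inside ∷ A) (outside ∷ B) →
                  #indep false (inside ∷ (A ∪ B)) ≡ #indep false (inside ∷ A) * #indep false (outside ∷ B)

#indep-∪ [] [] _ = refl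
#indep-∪ (outside ∷ A) (outside ∷ B) sep
  rewrite #indep-outside false (A ∪ B) | #indep-outside false A | #indep-outside false B =
  #indep-∪ A B (separated-tail sep)
#indep-∪ (inside ∷ A) (outside ∷ B) sep = #indep-∪-inside A B sep
-- Commutativity of the union reduces a first vertex in `B` to the case of a first vertex in `A`.
#indep-∪ (outside ∷ A) (inside ∷ B) sep = trans
  (trans (cong (λ C → #indep false (inside ∷ C)) (∪-comm A B)) (#indep-∪-inside B A (separated-sym sep)))
  (*-comm (#indep false (inside ∷ B)) _)
#indep-∪ (inside ∷ A) (inside ∷ B) sep = contradiction refl (proj₁ (sep here here))

#indep-∪-inside A B sep
  rewrite #indep-inside (A ∪ B) | #indep-inside A | #indep-outside false B
        | #indep-∪ A B (separated-tail sep)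
        | #indep-∪-blocked A B (separated-tail sep) (separated-head sep) =
  sym (*-distribʳ-+ (#indep false B) (#indep false A) (#indep true A))

#indep-∪-blocked [] [] _ _ = refl
#indep-∪-blocked (s ∷ A) (inside ∷ B) sep az = contradiction refl (az here)
#indep-∪-blocked (outside ∷ A) (outside ∷ B) sep az
  rewrite #indep-outside true (A ∪ B) | #indep-outside true A | #indep-outside false B =
  #indep-∪ A B (separated-tail sep)
#indep-∪-blocked (inside ∷ A) (outside ∷ B) sep az
  rewrite #indep-blocked (A ∪ B) | #indep-blocked A | #indep-outside false B =
  #indep-∪ A B (separated-tail sep)

-- Intervals and Fibonacci numbers

Convex : ∀ {n} → Subset n → Set
Convex B = ∀ {i j l} → i ∈ B → l ∈ B → toℕ i ≤ toℕ j → toℕ j ≤ toℕ l → j ∈ B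

DownClosed : ∀ {n} → Subset n → Set
DownClosed B = ∀ {j l} → l ∈ B → toℕ j ≤ toℕ l → j ∈ B

fib-suc : ∀ k → fib (suc k + 2) ≡ fib (k + 2) + fib (k + 1)
fib-suc k rewrite +-comm k 2 | +-comm k 1 = +-comm (fib (suc k)) _

-- A down-closed set is an initial segment. The two flag values are counted together because the
-- free count of a segment is the sum of both counts of its tail, which is the Fibonacci recurrence.
#indep-downClosed : ∀ {n} (B : Subset n) → DownClosed B →
                    #indep false B ≡ fib (∣ B ∣ + 2) × #indep true B ≡ fib (∣ B ∣ + 1)
#indep-downClosed [] _ = refl , refl
#indep-downClosed {suc n} (outside ∷ B) dc
  rewrite Empty-unique {p = B} (λ { (_ , i∈B) → contradiction (dc {zero} (there i∈B) z≤n) λ () })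
        | #indep-outside false (⊥ {n}) | #indep-⊥ n | ∣⊥∣≡0 n = refl , refl
#indep-downClosed (inside ∷ B) dc
  with f , t ← #indep-downClosed B (λ l∈B j≤l → drop-there (dc (there l∈B) (s≤s j≤l)))
  rewrite #indep-inside B | #indep-blocked B | f | t =
  sym (fib-suc ∣ B ∣) , cong fib (+-suc ∣ B ∣ 1)

-- Dropping the vertices in front of the least element turns a convex set into an initial segment.
#indep-convex : ∀ {n} (B : Subset n) → Convex B → #indep false B ≡ fib (∣ B ∣ + 2)
#indep-convex [] _ = refl
#indep-convex (outside ∷ B) cv = trans (#indep-outside false B)
  (#indep-convex B λ i∈B l∈B i≤j j≤l → drop-there (cv (there i∈B) (there l∈B) (s≤s i≤j) (s≤s j≤l)))
#indep-convex (inside ∷ B) cv = proj₁ (#indep-downClosed (inside ∷ B) λ l∈B j≤l → cv here l∈B z≤n j≤l)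

⋃ : ∀ {n k} → Vec (Subset n) k → Subset n
⋃ []       = ⊥
⋃ (b ∷ bs) = b ∪ ⋃ bs

∈-⋃⁺ : ∀ {n k} (bs : Vec (Subset n) k) {i} j → i ∈ lookup bs j → i ∈ ⋃ bs
∈-⋃⁺ (b ∷ bs) zero    i∈b = x∈p∪q⁺ (inj₁ i∈b)
∈-⋃⁺ (b ∷ bs) (suc j) i∈b = x∈p∪q⁺ (inj₂ (∈-⋃⁺ bs j i∈b))

∈-⋃⁻ : ∀ {n k} (bs : Vec (Subset n) k) {i} → i ∈ ⋃ bs → ∃ λ j → i ∈ lookup bs j
∈-⋃⁻ []       i∈ = contradiction i∈ ∉⊥
∈-⋃⁻ (b ∷ bs) i∈ with x∈p∪q⁻ b (⋃ bs) i∈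
... | inj₁ i∈b  = zero , i∈b
... | inj₂ i∈bs with j , i∈j ← ∈-⋃⁻ bs i∈bs = suc j , i∈j

#indep-⋃ : ∀ {n k} (bs : Vec (Subset n) k) → (∀ j → Convex (lookup bs j)) →
           (∀ j j′ → j ≢ j′ → Separated (lookup bs j) (lookup bs j′)) →
           #indep false (⋃ bs) ≡ prodFib bs
#indep-⋃ {n} [] cv sep = #indep-⊥ n
#indep-⋃ (b ∷ bs) cv sep = trans
  (#indep-∪ b (⋃ bs) λ i∈b l∈bs → let j , l∈j = ∈-⋃⁻ bs l∈bs in sep zero (suc j) (λ ()) i∈b l∈j)
  (cong₂ _*_ (#indep-convex b (cv zero))
             (#indep-⋃ bs (cv ∘ suc) λ j j′ j≢j′ → sep (suc j) (suc j′) λ { refl → j≢j′ refl }))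

-- Edges and components of the Coxeter graph

coxℕ-edge⁻ : ∀ n a b → 3 ≤ coxℕ n a b → suc a ≡ b ⊎ suc b ≡ a
coxℕ-edge⁻ n a b h with a ≡ᵇ b | suc a ≡ᵇ b in eq₁ | suc b ≡ᵇ a in eq₂
coxℕ-edge⁻ n a b (s≤s ())       | true  | _     | _
coxℕ-edge⁻ n a b h              | false | true  | _     = inj₁ (≡ᵇ⇒≡ (suc a) b (Equivalence.from T-≡ eq₁))
coxℕ-edge⁻ n a b h              | false | false | true  = inj₂ (≡ᵇ⇒≡ (suc b) a (Equivalence.from T-≡ eq₂))
coxℕ-edge⁻ n a b (s≤s (s≤s ())) | false | false | false

coxℕ-edge⁺ : ∀ n a b → suc a ≡ b ⊎ suc b ≡ a → 3 ≤ coxℕ n a b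
coxℕ-edge⁺ n a b adj
  with a ≡ᵇ b in eq₀ | suc a ≡ᵇ b in eq₁ | suc b ≡ᵇ a in eq₂ | (a + b + 3) ≡ᵇ (2 * n)
... | true  | _     | _     | _     with refl ← ≡ᵇ⇒≡ a b (Equivalence.from T-≡ eq₀) = ⊥-elim ([ 1+n≢n , 1+n≢n ]′ adj)
... | false | true  | _     | true  = s≤s (s≤s (s≤s z≤n))
... | false | true  | _     | false = s≤s (s≤s (s≤s z≤n))
... | false | false | true  | true  = s≤s (s≤s (s≤s z≤n))
... | false | false | true  | false = s≤s (s≤s (s≤s z≤n))
coxℕ-edge⁺ n a b (inj₁ e) | false | false | false | _ with () ← trans (sym eq₁) (Equivalence.to T-≡ (≡⇒≡ᵇ (suc a) b e))
coxℕ-edge⁺ n a b (inj₂ e) | false | false | false | _ with () ← trans (sym eq₂) (Equivalence.to T-≡ (≡⇒≡ᵇ (suc b) a e))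

-- A discrete intermediate value argument: an edge changes the index by one, so a walk from `x` to
-- `y` cannot jump over `j`.
walk-convex : ∀ {n B x y} → Walk n B x y → ∀ {j} → toℕ x ≤ toℕ j → toℕ j ≤ toℕ y → j ∈ B
walk-convex (here x∈B) x≤j j≤x rewrite toℕ-injective (≤-antisym x≤j j≤x) = x∈B
walk-convex {n} {B} (step {x} {z} x∈B edge walk) {j} x≤j j≤y with m≤n⇒m<n∨m≡n x≤j
... | inj₂ x≡j rewrite toℕ-injective x≡j = x∈B
... | inj₁ x<j = walk-convex walk (≤-trans z≤1+x x<j) j≤y
  where
  z≤1+x : toℕ z ≤ suc (toℕ x)
  z≤1+x with coxℕ-edge⁻ n (toℕ x) (toℕ z) edge
  ... | inj₁ e = ≤-reflexive (sym e)
  ... | inj₂ e = ≤-trans (n≤1+n _) (≤-trans (≤-reflexive e) (n≤1+n _))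

#indep-components : ∀ {n k} (bs : Vec (Subset n) k) (A : Subset n) →
                    IsComponents n (_∈ A) k bs → #indep false A ≡ prodFib bs
#indep-components {n} bs A (cover , unique , ⊆A , _ , connected , closed) =
  trans (cong (#indep false) A≡⋃) (#indep-⋃ bs
    (λ j i∈ l∈ → walk-convex (connected j _ _ i∈ l∈))
    (λ j j′ j≢j′ {x} {y} x∈ y∈ →
      (λ { refl → j≢j′ (unique x j j′ x∈ y∈) }) ,
      (λ e → j≢j′ (closed j j′ x y x∈ y∈ (coxℕ-edge⁺ n (toℕ x) (toℕ y) (inj₁ (sym e))))) ,
      (λ e → j≢j′ (closed j j′ x y x∈ y∈ (coxℕ-edge⁺ n (toℕ x) (toℕ y) (inj₂ (sym e)))))))
  where
  A≡⋃ : A ≡ ⋃ bs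
  A≡⋃ = ⊆-antisym (λ i∈A → let j , i∈j = cover _ i∈A in ∈-⋃⁺ bs j i∈j)
                  (λ i∈⋃ → let j , i∈j = ∈-⋃⁻ bs i∈⋃ in ⊆A j _ i∈j)

-- Lists

unique-++⁻ˡ : ∀ (xs : List A) {ys} → Unique (xs ++ ys) → Unique xs
unique-++⁻ˡ []       _       = []
unique-++⁻ˡ (x ∷ xs) (p ∷ u) = All.++⁻ˡ xs p ∷ unique-++⁻ˡ xs u

unique-++⁻ʳ : ∀ (xs : List A) {ys} → Unique (xs ++ ys) → Unique ys
unique-++⁻ʳ []       u       = u
unique-++⁻ʳ (x ∷ xs) (_ ∷ u) = unique-++⁻ʳ xs u

unique-++-disjoint : ∀ (xs : List A) {ys z} → Unique (xs ++ ys) → z ∈ₗ xs → z ∉ₗ ys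
unique-++-disjoint (x ∷ xs) (p ∷ u) (here refl)  z∈ys = All.lookup p (∈-++⁺ʳ xs z∈ys) refl
unique-++-disjoint (x ∷ xs) (p ∷ u) (there z∈xs) z∈ys = unique-++-disjoint xs u z∈xs z∈ys

unique-split : ∀ {xs : List A} {z} → Unique xs → z ∈ₗ xs → ∃ λ us → ∃ λ ws → xs ≡ us ++ z ∷ ws × z ∉ₗ us × z ∉ₗ ws
unique-split u z∈xs with us , ws , refl ← ∈-∃++ z∈xs =
  us , ws , refl , (λ z∈us → unique-++-disjoint us u z∈us (here refl)) , Unique[x∷xs]⇒x∉xs (unique-++⁻ʳ us u)

unique-↭ : ∀ {xs ys : List A} → xs ↭ ys → Unique xs → Unique ys
unique-↭ π = PermSetoid.Unique-resp-↭ (setoid _) (↭⇒↭ₛ π)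

∈-tail : ∀ {x z : A} {xs ws} → All.All (x ≢_) xs → z ∈ₗ xs → z ∈ₗ x ∷ ws → z ∈ₗ ws
∈-tail p z∈xs (here refl) = contradiction refl (All.lookup p z∈xs)
∈-tail p z∈xs (there h)   = h

⊆⇒↭-++ : ∀ {xs ys : List A} → Unique xs → (∀ {z} → z ∈ₗ xs → z ∈ₗ ys) → ∃ λ zs → ys ↭ xs ++ zs
⊆⇒↭-++ {xs = []}     []      _     = _ , ↭-refl
⊆⇒↭-++ {xs = x ∷ xs} (p ∷ u) xs⊆ys with as , bs , refl ← ∈-∃++ (xs⊆ys (here refl))
  with zs , π ← ⊆⇒↭-++ u (λ {z} z∈xs → ∈-tail p z∈xs (∈-resp-↭ (shift x as bs) (xs⊆ys (there z∈xs)))) =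
  zs , ↭-trans (shift x as bs) (prep x π)

-- A pigeonhole argument: once `xs` is extracted from `ys`, the lengths leave no room for a
-- remainder. It turns a word that contains all required letters and is short enough into a
-- rearrangement of them.
⊆-length⇒↭ : ∀ {xs ys : List A} → Unique xs → (∀ {z} → z ∈ₗ xs → z ∈ₗ ys) → length ys ≤ length xs → ys ↭ xs
⊆-length⇒↭ {xs = xs} {ys} u xs⊆ys le with ⊆⇒↭-++ u xs⊆ys
... | []     , π = ↭-trans π (↭-reflexive (++-identityʳ xs))
... | z ∷ zs , π = contradiction (≤-trans (≤-reflexive (sym (trans (↭-length π) (length-++ xs)))) le)
                     (<⇒≱ (m<m+n (length xs) (s≤s z≤n)))

set-↭ : ∀ {xs ys : List A} → Unique xs → Unique ys →
        (∀ {z} → z ∈ₗ xs → z ∈ₗ ys) → (∀ {z} → z ∈ₗ ys → z ∈ₗ xs) → xs ↭ ys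
set-↭ {xs = xs} {ys} uxs uys xs⊆ys ys⊆xs with zs , π ← ⊆⇒↭-++ uxs xs⊆ys =
  ⊆-length⇒↭ uys ys⊆xs (≤-trans (m≤m+n (length xs) (length zs)) (≤-reflexive (sym (trans (↭-length π) (length-++ xs)))))

lookup-injectiveₗ : ∀ {xs : List A} → Unique xs → ∀ {i j} → List.lookup xs i ≡ List.lookup xs j → i ≡ j
lookup-injectiveₗ {xs = x ∷ xs} (p ∷ u) {zero}  {zero}  _  = refl
lookup-injectiveₗ {xs = x ∷ xs} (p ∷ u) {suc i} {suc j} eq = cong suc (lookup-injectiveₗ u eq)
lookup-injectiveₗ {xs = x ∷ xs} (p ∷ u) {zero}  {suc j} eq = contradiction eq (All.lookup p (∈-lookup j))
lookup-injectiveₗ {xs = x ∷ xs} (p ∷ u) {suc i} {zero}  eq = contradiction (sym eq) (All.lookup p (∈-lookup i))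

-- Subsets as lists and decidable predicates as subsets

elems : ∀ {n} → Subset n → List (Fin n)
elems T = filter (_∈? T) (allFin _)

elems-unique : ∀ {n} (T : Subset n) → Unique (elems T)
elems-unique T = filter⁺ (_∈? T) (allFin⁺ _)

∈-elems⁺ : ∀ {n} {T : Subset n} {i} → i ∈ T → i ∈ₗ elems T
∈-elems⁺ {T = T} {i} i∈T = ∈-filter⁺ (_∈? T) (∈-allFin i) i∈T

∈-elems⁻ : ∀ {n} {T : Subset n} {i} → i ∈ₗ elems T → i ∈ T
∈-elems⁻ {n} {T} i∈ = proj₂ (∈-filter⁻ (_∈? T) {xs = allFin n} i∈)

module _ {n} {P : Fin n → Set} (P? : Decidable P) where

  subsetOf : Subset n
  subsetOf = tabulate (does ∘ P?)

  ∈-subsetOf⁺ : ∀ {i} → P i → i ∈ subsetOf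
  ∈-subsetOf⁺ {i} Pi = lookup⇒[]= i _ (trans (lookup∘tabulate _ i) (dec-true (P? i) Pi))

  ∈-subsetOf⁻ : ∀ {i} → i ∈ subsetOf → P i
  ∈-subsetOf⁻ {i} i∈ with P? i in eq
  ... | yes Pi = Pi
  ... | no  _  with () ← trans (sym ([]=⇒lookup i∈)) (trans (lookup∘tabulate _ i) (cong does eq))

∣∣-strict-mono : ∀ {n} {p q : Subset n} → p ⊆ q → ¬ q ⊆ p → ∣ p ∣ < ∣ q ∣
∣∣-strict-mono {p = []} {[]} _ q⊈p = contradiction (λ ()) q⊈p
∣∣-strict-mono {p = outside ∷ p} {outside ∷ q} p⊆q q⊈p = ∣∣-strict-mono (drop-∷-⊆ p⊆q) λ q⊆p → q⊈p (out⊆ q⊆p)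
∣∣-strict-mono {p = outside ∷ p} {inside ∷ q} p⊆q q⊈p = s≤s (p⊆q⇒∣p∣≤∣q∣ (drop-∷-⊆ p⊆q))
∣∣-strict-mono {p = inside ∷ p} {outside ∷ q} p⊆q q⊈p with () ← p⊆q here
∣∣-strict-mono {p = inside ∷ p} {inside ∷ q} p⊆q q⊈p = s≤s (∣∣-strict-mono (drop-∷-⊆ p⊆q)
  λ q⊆p → q⊈p λ { here → here ; (there z∈q) → there (q⊆p z∈q) })

-- Permutations in one-line notation

vec-ext : {u v : Vec X k} → (∀ i → lookup u i ≡ lookup v i) → u ≡ v
vec-ext {u = u} {v} eq = trans (sym (tabulate∘lookup u)) (trans (tabulate-cong eq) (tabulate∘lookup v))

lookup-· : (u x : Perm m) (p : Fin m) → lookup (u · x) p ≡ lookup u (lookup x p)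
lookup-· u x p = lookup∘tabulate _ p

·-assoc : (u x y : Perm m) → (u · x) · y ≡ u · (x · y)
·-assoc u x y = vec-ext λ p → begin
  lookup ((u · x) · y) p            ≡⟨ lookup-· (u · x) y p ⟩
  lookup (u · x) (lookup y p)       ≡⟨ lookup-· u x _ ⟩
  lookup u (lookup x (lookup y p))  ≡⟨ cong (lookup u) (lookup-· x y p) ⟨
  lookup u (lookup (x · y) p)       ≡⟨ lookup-· u (x · y) p ⟨
  lookup (u · (x · y)) p            ∎
  where open ≡-Reasoning

·-identityʳ : (u : Perm m) → u · idP ≡ u
·-identityʳ u = vec-ext λ p → trans (lookup-· u idP p) (cong (lookup u) (lookup-allFin p))

·-identityˡ : (u : Perm m) → idP · u ≡ u
·-identityˡ u = vec-ext λ p → trans (lookup-· idP u p) (lookup-allFin _)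

-- Adjacent transpositions

adjSwap-lo : ∀ a (p : Fin m) → toℕ p ≡ a → suc a < m → toℕ (adjSwap a p) ≡ suc a
adjSwap-lo {suc (suc m)} zero    zero    _  _         = refl
adjSwap-lo {suc zero}    zero    zero    _  (s≤s ())
adjSwap-lo {suc (suc m)} (suc a) (suc p) eq (s≤s a<m) = cong suc (adjSwap-lo a p (suc-injective eq) a<m)

adjSwap-hi : ∀ a (p : Fin m) → toℕ p ≡ suc a → toℕ (adjSwap a p) ≡ a
adjSwap-hi {suc (suc m)} zero    (suc zero) _  = refl
adjSwap-hi {suc (suc m)} (suc a) (suc p)    eq = cong suc (adjSwap-hi a p (suc-injective eq))

adjSwap-fix : ∀ a (p : Fin m) → toℕ p ≢ a → toℕ p ≢ suc a → adjSwap a p ≡ p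
adjSwap-fix {suc (suc m)} zero    zero          p≢a _    = contradiction refl p≢a
adjSwap-fix {suc (suc m)} zero    (suc zero)    _   p≢sa = contradiction refl p≢sa
adjSwap-fix {suc (suc m)} zero    (suc (suc p)) _   _    = refl
adjSwap-fix {suc zero}    zero    zero          _   _    = refl
adjSwap-fix {suc zero}    (suc a) zero          _   _    = refl
adjSwap-fix {suc (suc m)} (suc a) zero          _   _    = refl
adjSwap-fix {suc (suc m)} (suc a) (suc p)       p≢a p≢sa =
  cong suc (adjSwap-fix a p (p≢a ∘ cong suc) (p≢sa ∘ cong suc))

adjSwap-involutive : ∀ a (p : Fin m) → adjSwap a (adjSwap a p) ≡ p
adjSwap-involutive {suc (suc m)} zero    zero          = refl
adjSwap-involutive {suc (suc m)} zero    (suc zero)    = refl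
adjSwap-involutive {suc (suc m)} zero    (suc (suc p)) = refl
adjSwap-involutive {suc zero}    zero    zero          = refl
adjSwap-involutive {suc zero}    (suc a) zero          = refl
adjSwap-involutive {suc (suc m)} (suc a) zero          = refl
adjSwap-involutive {suc (suc m)} (suc a) (suc p)       = cong suc (adjSwap-involutive a p)

adjSwap-zero : ∀ a → adjSwap {suc m} (suc a) zero ≡ zero
adjSwap-zero {zero}  a = refl
adjSwap-zero {suc m} a = refl

adjSwap-comm : ∀ a b (p : Fin m) → suc a < b → adjSwap a (adjSwap b p) ≡ adjSwap b (adjSwap a p)
adjSwap-comm {suc zero}    zero    (suc (suc b)) zero          _ = refl
adjSwap-comm {suc (suc m)} zero    (suc (suc b)) zero          _ = cong suc (sym (adjSwap-zero {m} b))
adjSwap-comm {suc (suc m)} zero    (suc (suc b)) (suc zero)    _ rewrite adjSwap-zero {m} b = refl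
adjSwap-comm {suc (suc (suc m))} zero (suc (suc b)) (suc (suc p)) _ = refl
adjSwap-comm {suc zero}    (suc a) (suc b)       zero          _ = refl
adjSwap-comm {suc (suc m)} (suc a) (suc b)       zero          _ = refl
adjSwap-comm {suc (suc m)} (suc a) (suc b)       (suc p)       (s≤s a<b) = cong suc (adjSwap-comm a b p a<b)
adjSwap-comm               zero    (suc zero)    _             (s≤s ())

adjSwap-≤ : ∀ a b (p : Fin m) → a ≢ b → toℕ p ≤ b → toℕ (adjSwap a p) ≤ b
adjSwap-≤ {suc (suc m)} zero    zero    _             a≢b _       = contradiction refl a≢b
adjSwap-≤ {suc (suc m)} zero    (suc b) zero          _   _       = s≤s z≤n
adjSwap-≤ {suc (suc m)} zero    (suc b) (suc zero)    _   _       = z≤n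
adjSwap-≤ {suc (suc m)} zero    (suc b) (suc (suc p)) _   p≤b     = p≤b
adjSwap-≤ {suc zero}    zero    b       zero          _   _       = z≤n
adjSwap-≤ {suc zero}    (suc a) b       zero          _   _       = z≤n
adjSwap-≤ {suc (suc m)} (suc a) b       zero          _   _       = z≤n
adjSwap-≤ {suc (suc m)} (suc a) (suc b) (suc p)       a≢b (s≤s h) = s≤s (adjSwap-≤ a b p (a≢b ∘ cong suc) h)

-- Mirror images are handled through this sum, so that later computations cancel summands in place
-- of reasoning about truncated subtraction.
opposite-sum : (p : Fin m) → suc (toℕ p) + toℕ (opposite p) ≡ m
opposite-sum {m} p = trans (cong (suc (toℕ p) +_) (opposite-prop p)) (m+[n∸m]≡n (toℕ<n p))

opposite-unique : (p q : Fin m) → suc (toℕ p) + toℕ q ≡ m → opposite p ≡ q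
opposite-unique p q eq = toℕ-injective
  (+-cancelˡ-≡ (suc (toℕ p)) _ _ (trans (opposite-sum p) (sym eq)))

opposite-mono-< : (p q : Fin m) → toℕ p < toℕ q → toℕ (opposite q) < toℕ (opposite p)
opposite-mono-< {m} p q p<q rewrite opposite-prop p | opposite-prop q = ∸-monoʳ-< (s≤s p<q) (toℕ<n q)

opposite-cancel-< : (p q : Fin m) → toℕ (opposite q) < toℕ (opposite p) → toℕ p < toℕ q
opposite-cancel-< p q h = subst₂ _<_ (cong toℕ (opposite-involutive p)) (cong toℕ (opposite-involutive q))
  (opposite-mono-< _ _ h)

-- With a + b + 2 = m, reversal sends the positions b, b + 1 to a + 1, a, so it conjugates one
-- transposition into the other.
adjSwap-opposite : ∀ a b (p : Fin m) → suc (suc (a + b)) ≡ m →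
                   adjSwap a (opposite p) ≡ opposite (adjSwap b p)
adjSwap-opposite {m} a b p eq with toℕ p ≟ b | toℕ p ≟ suc b
... | yes refl | _ = sym (opposite-unique _ _ (begin
  suc (toℕ (adjSwap b p)) + toℕ (adjSwap a (opposite p))
    ≡⟨ cong₂ (λ x y → suc x + y) (adjSwap-lo b p refl b<m) (adjSwap-hi a (opposite p) opp) ⟩
  suc (suc b) + a        ≡⟨ cong (2 +_) (+-comm b a) ⟩
  suc (suc (a + b))      ≡⟨ eq ⟩
  m                      ∎))
  where
  open ≡-Reasoning
  b<m : suc b < m
  b<m = subst (suc b <_) eq (s≤s (s≤s (m≤n+m b a)))
  opp : toℕ (opposite p) ≡ suc a
  opp = +-cancelˡ-≡ (suc b) _ _ (trans (opposite-sum p)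
    (trans (sym eq) (cong suc (trans (cong suc (+-comm a b)) (sym (+-suc b a))))))
... | no _ | yes p≡sb = sym (opposite-unique _ _ (begin
  suc (toℕ (adjSwap b p)) + toℕ (adjSwap a (opposite p))
    ≡⟨ cong₂ (λ x y → suc x + y) (adjSwap-hi b p p≡sb) (adjSwap-lo a (opposite p) opp a<m) ⟩
  suc b + suc a          ≡⟨ cong suc (trans (+-suc b a) (cong suc (+-comm b a))) ⟩
  suc (suc (a + b))      ≡⟨ eq ⟩
  m                      ∎))
  where
  open ≡-Reasoning
  a<m : suc a < m
  a<m = subst (suc a <_) eq (s≤s (s≤s (m≤m+n a b)))
  opp : toℕ (opposite p) ≡ a
  opp = +-cancelˡ-≡ (suc (suc b)) _ _ (trans (cong (λ x → suc x + toℕ (opposite p)) (sym p≡sb))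
    (trans (opposite-sum p) (trans (sym eq) (cong (2 +_) (+-comm a b)))))
... | no p≢b | no p≢sb = trans
  (adjSwap-fix a (opposite p)
    (λ e → p≢sb (+-cancelʳ-≡ a _ _ (suc-injective (trans (cong (suc (toℕ p) +_) (sym e)) sum))))
    (λ e → p≢b (+-cancelʳ-≡ (suc a) _ _ (trans (suc-injective (trans (cong (suc (toℕ p) +_) (sym e)) sum)) (sym (+-suc b a))))))
  (cong opposite (sym (adjSwap-fix b p p≢b p≢sb)))
  where
  sum : suc (toℕ p) + toℕ (opposite p) ≡ suc (suc (b + a))
  sum = trans (opposite-sum p) (trans (sym eq) (cong (2 +_) (+-comm a b)))

-- Inversions of a word

-- Right multiplication by an adjacent transposition in structurally recursive form, so that
-- statistics defined by recursion on the vector can be followed through it.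
swapAt : ℕ → Vec X k → Vec X k
swapAt a       []           = []
swapAt zero    (x ∷ [])     = x ∷ []
swapAt zero    (x ∷ y ∷ xs) = y ∷ x ∷ xs
swapAt (suc a) (x ∷ xs)     = x ∷ swapAt a xs

lookup-swapAt : ∀ a (xs : Vec X k) p → lookup (swapAt a xs) p ≡ lookup xs (adjSwap a p)
lookup-swapAt zero    (x ∷ [])     zero          = refl
lookup-swapAt zero    (x ∷ y ∷ xs) zero          = refl
lookup-swapAt zero    (x ∷ y ∷ xs) (suc zero)    = refl
lookup-swapAt zero    (x ∷ y ∷ xs) (suc (suc p)) = refl
lookup-swapAt (suc a) (x ∷ [])     zero          = refl
lookup-swapAt (suc a) (x ∷ y ∷ xs) zero          = refl
lookup-swapAt (suc a) (x ∷ y ∷ xs) (suc p)       = lookup-swapAt a (y ∷ xs) p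

χ : ℕ → ℕ → ℕ
χ a b = if a <ᵇ b then 1 else 0

χ-< : ∀ {a b} → a < b → χ a b ≡ 1
χ-< a<b rewrite Equivalence.to T-≡ (<⇒<ᵇ a<b) = refl

χ-≥ : ∀ {a b} → b ≤ a → χ a b ≡ 0
χ-≥ {a} {b} b≤a with a <ᵇ b in eq
... | false = refl
... | true  = contradiction (<ᵇ⇒< a b (Equivalence.from T-≡ eq)) (≤⇒≯ b≤a)

below : Fin m → Vec (Fin m) k → ℕ
below x []       = 0
below x (y ∷ ys) = χ (toℕ y) (toℕ x) + below x ys

inv : Vec (Fin m) k → ℕ
inv []       = 0
inv (x ∷ xs) = below x xs + inv xs

below-swapAt : ∀ (x : Fin m) a (ys : Vec (Fin m) k) → below x (swapAt a ys) ≡ below x ys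
below-swapAt x a       []           = refl
below-swapAt x zero    (y ∷ [])     = refl
below-swapAt x zero    (y ∷ z ∷ ys) =
  solve 3 (λ a b c → b :+ (a :+ c) := a :+ (b :+ c)) refl (χ (toℕ y) (toℕ x)) (χ (toℕ z) (toℕ x)) (below x ys)
  where open +-*-Solver
below-swapAt x (suc a) (y ∷ ys)     = cong (χ (toℕ y) (toℕ x) +_) (below-swapAt x a ys)

inv-swapAt : ∀ a (xs : Vec (Fin m) k) (p q : Fin k) → toℕ p ≡ a → toℕ q ≡ suc a →
             toℕ (lookup xs p) < toℕ (lookup xs q) → inv (swapAt a xs) ≡ suc (inv xs)
inv-swapAt zero (x ∷ y ∷ xs) zero (suc zero) _ _ x<y rewrite χ-< x<y | χ-≥ (<⇒≤ x<y) =
  solve 3 (λ a b c → (con 1 :+ b) :+ (a :+ c) := con 1 :+ (a :+ (b :+ c))) refl (below x xs) (below y xs) (inv xs)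
  where open +-*-Solver
inv-swapAt (suc a) (x ∷ xs) (suc p) (suc q) eqp eqq h
  rewrite below-swapAt x a xs | inv-swapAt a xs p q (suc-injective eqp) (suc-injective eqq) h =
  +-suc (below x xs) (inv xs)

-- Counts the entries `≥ h` among the first `r`. For `h = r = n` these are the negative entries when
-- a centrally symmetric permutation is read as a signed one.
upper : ℕ → ℕ → Vec (Fin m) k → ℕ
upper h zero    xs       = 0
upper h (suc r) []       = 0
upper h (suc r) (x ∷ xs) = χ h (suc (toℕ x)) + upper h r xs

upper-swapAt-left : ∀ h r a (xs : Vec (Fin m) k) → suc a < r → upper h r (swapAt a xs) ≡ upper h r xs
upper-swapAt-left h (suc r)       a       []           _ = refl
upper-swapAt-left h (suc r)       zero    (x ∷ [])     _ = refl
upper-swapAt-left h (suc (suc r)) zero    (x ∷ y ∷ xs) _ =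
  solve 3 (λ a b c → b :+ (a :+ c) := a :+ (b :+ c)) refl (χ h (suc (toℕ x))) (χ h (suc (toℕ y))) (upper h r xs)
  where open +-*-Solver
upper-swapAt-left h (suc zero)    zero    (x ∷ y ∷ xs) (s≤s ())
upper-swapAt-left h (suc r)       (suc a) (x ∷ xs)     (s≤s a<r) =
  cong (χ h (suc (toℕ x)) +_) (upper-swapAt-left h r a xs a<r)

upper-swapAt-right : ∀ h r a (xs : Vec (Fin m) k) → r ≤ a → upper h r (swapAt a xs) ≡ upper h r xs
upper-swapAt-right h zero    a       xs       _         = refl
upper-swapAt-right h (suc r) (suc a) []       _         = refl
upper-swapAt-right h (suc r) (suc a) (x ∷ xs) (s≤s r≤a) =
  cong (χ h (suc (toℕ x)) +_) (upper-swapAt-right h r a xs r≤a)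

upper-swapAt-cross : ∀ h a (xs : Vec (Fin m) k) (p q : Fin k) → toℕ p ≡ a → toℕ q ≡ suc a →
                     toℕ (lookup xs p) < h → h ≤ toℕ (lookup xs q) →
                     upper h (suc a) (swapAt a xs) ≡ suc (upper h (suc a) xs)
upper-swapAt-cross h zero (x ∷ y ∷ xs) zero (suc zero) _ _ x<h h≤y rewrite χ-< (s≤s h≤y) | χ-≥ x<h = refl
upper-swapAt-cross h (suc a) (x ∷ xs) (suc p) (suc q) eqp eqq x<h h≤y
  rewrite upper-swapAt-cross h a xs p q (suc-injective eqp) (suc-injective eqq) x<h h≤y =
  +-suc (χ h (suc (toℕ x))) _

below-none : (x : Fin m) (ys : Vec (Fin m) k) → (∀ p → toℕ x ≤ toℕ (lookup ys p)) → below x ys ≡ 0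
below-none x []       h = refl
below-none x (y ∷ ys) h rewrite χ-≥ (h zero) = below-none x ys (h ∘ suc)

inv-sorted : (xs : Vec (Fin m) k) → (∀ p q → toℕ p < toℕ q → toℕ (lookup xs p) ≤ toℕ (lookup xs q)) → inv xs ≡ 0
inv-sorted []       h = refl
inv-sorted (x ∷ xs) h rewrite below-none x xs (λ p → h zero (suc p) (s≤s z≤n)) =
  inv-sorted xs (λ p q p<q → h (suc p) (suc q) (s≤s p<q))

upper-none : ∀ h r (xs : Vec (Fin m) k) → (∀ p → toℕ p < r → toℕ (lookup xs p) < h) → upper h r xs ≡ 0
upper-none h zero    xs       _  = refl
upper-none h (suc r) []       _  = refl
upper-none h (suc r) (x ∷ xs) lt rewrite χ-≥ (lt zero (s≤s z≤n)) = upper-none h r xs (λ p p<r → lt (suc p) (s≤s p<r))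

-- The action of the generators on positions

Far : Fin k → Fin k → Set
Far i j = suc (toℕ i) < toℕ j ⊎ suc (toℕ j) < toℕ i

far-apart : ∀ {a b c} → suc a < b ⊎ suc b < a → c ≡ b ⊎ c ≡ suc b → c ≢ a × c ≢ suc a
far-apart (inj₁ h) (inj₁ refl) = (<⇒≢ (<-trans (n<1+n _) h) ∘ sym) , (<⇒≢ h ∘ sym)
far-apart (inj₁ h) (inj₂ refl) = (<⇒≢ (m≤n⇒m≤1+n (<-trans (n<1+n _) h)) ∘ sym) , (<⇒≢ (m≤n⇒m≤1+n h) ∘ sym)
far-apart (inj₂ h) (inj₁ refl) = <⇒≢ (<-trans (n<1+n _) h) , <⇒≢ (m≤n⇒m≤1+n (<-trans (n<1+n _) h))
far-apart (inj₂ h) (inj₂ refl) = <⇒≢ h , <⇒≢ (m≤n⇒m≤1+n h)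

module TypeC (n : ℕ) where

  open DecMembership (_≟F_ {n}) using () renaming (_∈?_ to _∈ₗ?_)

  2n≡n+n : 2 * n ≡ n + n
  2n≡n+n = cong (n +_) (+-identityʳ n)

  mirror : Fin n → ℕ
  mirror i = 2 * n ∸ 2 ∸ toℕ i

  mirror-sum : ∀ i → suc (toℕ i) < n → suc (suc (toℕ i + mirror i)) ≡ 2 * n
  mirror-sum i i<n = trans (cong (2 +_) (m+[n∸m]≡n (∸-monoˡ-≤ 2 2+i≤2n))) (m+[n∸m]≡n {2} (≤-trans (s≤s (s≤s z≤n)) 2+i≤2n))
    where
    2+i≤2n : 2 + toℕ i ≤ 2 * n
    2+i≤2n = ≤-trans i<n (m≤m+n n _)

  -- The mirrored transposition acts within the right half, so positions below `n` see only the
  -- other one.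
  n≤mirror : ∀ i → suc (toℕ i) < n → n ≤ mirror i
  n≤mirror i i<n = +-cancelˡ-≤ n _ _ (begin
    n + n                      ≡⟨ 2n≡n+n ⟨
    2 * n                      ≡⟨ mirror-sum i i<n ⟨
    2 + toℕ i + mirror i       ≤⟨ +-monoˡ-≤ (mirror i) i<n ⟩
    n + mirror i               ∎)
    where open ≤-Reasoning

  σ : Fin n → Fin (2 * n) → Fin (2 * n)
  σ i = lookup (gen n i)

  σ-inner : ∀ i p → suc (toℕ i) < n → σ i p ≡ adjSwap (toℕ i) (adjSwap (mirror i) p)
  σ-inner i p i<n = trans (lookup∘tabulate _ p)
    (cong (λ b → if b then adjSwap (toℕ i) (adjSwap (mirror i) p) else adjSwap (toℕ i) p) (Equivalence.to T-≡ (<⇒<ᵇ i<n)))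

  σ-last : ∀ i p → suc (toℕ i) ≡ n → σ i p ≡ adjSwap (toℕ i) p
  σ-last i p i≡n = trans (lookup∘tabulate _ p) (helper (suc (toℕ i) <ᵇ n) refl)
    where
    helper : ∀ b → (suc (toℕ i) <ᵇ n) ≡ b → (if b then adjSwap (toℕ i) (adjSwap (mirror i) p) else adjSwap (toℕ i) p) ≡ adjSwap (toℕ i) p
    helper false _  = refl
    helper true  eq = contradiction (<ᵇ⇒< (suc (toℕ i)) n (Equivalence.from T-≡ eq)) (≤⇒≯ (≤-reflexive (sym i≡n)))

  position-cases : ∀ (i : Fin n) → suc (toℕ i) < n ⊎ suc (toℕ i) ≡ n
  position-cases i = m≤n⇒m<n∨m≡n (toℕ<n i)

  i<mirror : ∀ i → suc (toℕ i) < n → suc (toℕ i) < mirror i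
  i<mirror i i<n = ≤-trans i<n (n≤mirror i i<n)

  σ-involutive : ∀ i p → σ i (σ i p) ≡ p
  σ-involutive i p with position-cases i
  ... | inj₂ i≡n rewrite σ-last i p i≡n | σ-last i (adjSwap (toℕ i) p) i≡n = adjSwap-involutive (toℕ i) p
  ... | inj₁ i<n
    rewrite σ-inner i p i<n | σ-inner i (adjSwap (toℕ i) (adjSwap (mirror i) p)) i<n
          | sym (adjSwap-comm (toℕ i) (mirror i) (adjSwap (mirror i) p) (i<mirror i i<n))
          | adjSwap-involutive (mirror i) p = adjSwap-involutive (toℕ i) p

  σ-opposite : ∀ i p → σ i (opposite p) ≡ opposite (σ i p)
  σ-opposite i p with position-cases i
  ... | inj₂ i≡n rewrite σ-last i p i≡n | σ-last i (opposite p) i≡n =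
    adjSwap-opposite (toℕ i) (toℕ i) p (trans (cong suc (trans (sym (+-suc _ _)) (cong (toℕ i +_) i≡n)))
      (trans (cong (_+ n) i≡n) (sym 2n≡n+n)))
  ... | inj₁ i<n rewrite σ-inner i p i<n | σ-inner i (opposite p) i<n = begin
    adjSwap (toℕ i) (adjSwap (mirror i) (opposite p))
      ≡⟨ cong (adjSwap (toℕ i)) (adjSwap-opposite (mirror i) (toℕ i) p (trans (cong (2 +_) (+-comm (mirror i) (toℕ i))) (mirror-sum i i<n))) ⟩
    adjSwap (toℕ i) (opposite (adjSwap (toℕ i) p))
      ≡⟨ adjSwap-opposite (toℕ i) (mirror i) _ (mirror-sum i i<n) ⟩
    opposite (adjSwap (mirror i) (adjSwap (toℕ i) p))
      ≡⟨ cong opposite (adjSwap-comm (toℕ i) (mirror i) p (i<mirror i i<n)) ⟨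
    opposite (adjSwap (toℕ i) (adjSwap (mirror i) p)) ∎
    where open ≡-Reasoning

  σ-inner-left : ∀ i p → suc (toℕ i) < n → toℕ p < mirror i → σ i p ≡ adjSwap (toℕ i) p
  σ-inner-left i p i<n p<mir = trans (σ-inner i p i<n)
    (cong (adjSwap (toℕ i)) (adjSwap-fix (mirror i) p (<⇒≢ p<mir) (<⇒≢ (m≤n⇒m≤1+n p<mir))))

  -- Up to position `i + 1` both kinds of generator act as one adjacent transposition, which spares
  -- a case split in statements about the positions `i` and `i + 1`.
  σ-near : ∀ i p → toℕ p ≤ suc (toℕ i) → σ i p ≡ adjSwap (toℕ i) p
  σ-near i p p≤i with position-cases i
  ... | inj₁ i<n = σ-inner-left i p i<n (≤-<-trans p≤i (i<mirror i i<n))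
  ... | inj₂ i≡n = σ-last i p i≡n

  1+i<2n : (i : Fin n) → suc (toℕ i) < 2 * n
  1+i<2n i = subst (suc (toℕ i) <_) (sym 2n≡n+n) (+-mono-≤ {1} (≤-trans (s≤s z≤n) (toℕ<n i)) (toℕ<n i))

  σ-lo : ∀ i p → toℕ p ≡ toℕ i → toℕ (σ i p) ≡ suc (toℕ i)
  σ-lo i p eq = trans (cong toℕ (σ-near i p (m≤n⇒m≤1+n (≤-reflexive eq)))) (adjSwap-lo (toℕ i) p eq (1+i<2n i))

  σ-hi : ∀ i p → toℕ p ≡ suc (toℕ i) → toℕ (σ i p) ≡ toℕ i
  σ-hi i p eq = trans (cong toℕ (σ-near i p (≤-reflexive eq))) (adjSwap-hi (toℕ i) p eq)

  -- The segment {0, ..., j} can be left only through the transposition of `j` and `j + 1`. It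
  -- belongs to `gen n j` alone, as mirrored transpositions act at positions `≥ n > j`.
  σ-≤ : ∀ i (j : Fin n) p → i ≢ j → toℕ p ≤ toℕ j → toℕ (σ i p) ≤ toℕ j
  σ-≤ i j p i≢j p≤j with position-cases i
  ... | inj₁ i<n = subst (λ q → toℕ q ≤ toℕ j) (sym (σ-inner-left i p i<n (≤-<-trans p≤j (<-≤-trans (toℕ<n j) (n≤mirror i i<n)))))
                     (adjSwap-≤ (toℕ i) (toℕ j) p (i≢j ∘ toℕ-injective) p≤j)
  ... | inj₂ i≡n = subst (λ q → toℕ q ≤ toℕ j) (sym (σ-last i p i≡n)) (adjSwap-≤ (toℕ i) (toℕ j) p (i≢j ∘ toℕ-injective) p≤j)

  σ-> : ∀ i (j : Fin n) p → i ≢ j → toℕ j < toℕ p → toℕ j < toℕ (σ i p)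
  σ-> i j p i≢j j<p = ≰⇒> λ h → <⇒≱ j<p
    (subst (λ q → toℕ q ≤ toℕ j) (σ-involutive i p) (σ-≤ i j (σ i p) i≢j h))

  -- The tight case is the last generator, whose transposition reaches position `n` of the right
  -- half. Being far from `j` forces i ≤ n - 3, hence `mirror i` is at least n + 1.
  far-mirror : ∀ (i j : Fin n) → suc (toℕ i) < toℕ j → suc (toℕ j) < mirror i
  far-mirror i j i<j = +-cancelˡ-≤ n _ _ (begin
    n + suc (suc (toℕ j))          ≤⟨ +-monoʳ-≤ n (s≤s (toℕ<n j)) ⟩
    n + suc n                      ≡⟨ +-suc n n ⟩
    suc (n + n)                    ≡⟨ cong suc 2n≡n+n ⟨
    suc (2 * n)                    ≡⟨ cong suc (mirror-sum i (<-trans i<j (toℕ<n j))) ⟨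
    3 + toℕ i + mirror i           ≤⟨ +-monoˡ-≤ (mirror i) (≤-trans (s≤s i<j) (toℕ<n j)) ⟩
    n + mirror i                   ∎)
    where open ≤-Reasoning

  -- For far generators the left halves of the supports are disjoint, and the mirrored half of s_i
  -- lies strictly to the right of position j + 1.
  σ-far : ∀ i (j : Fin n) p → Far i j → toℕ p ≡ toℕ j ⊎ toℕ p ≡ suc (toℕ j) → σ i p ≡ p
  σ-far i j p far p∈ with position-cases i
  ... | inj₂ i≡n = trans (σ-last i p i≡n) (adjSwap-fix (toℕ i) p (far-apart far p∈ .proj₁) (far-apart far p∈ .proj₂))
  ... | inj₁ i<n = trans (σ-inner-left i p i<n (≤-<-trans (p≤ p∈) (j<mirror far)))
                     (adjSwap-fix (toℕ i) p (far-apart far p∈ .proj₁) (far-apart far p∈ .proj₂))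
    where
    p≤ : toℕ p ≡ toℕ j ⊎ toℕ p ≡ suc (toℕ j) → toℕ p ≤ suc (toℕ j)
    p≤ (inj₁ e) = m≤n⇒m≤1+n (≤-reflexive e)
    p≤ (inj₂ e) = ≤-reflexive e
    j<mirror : Far i j → suc (toℕ j) < mirror i
    j<mirror (inj₂ h) = <-≤-trans (<-trans h (toℕ<n i)) (n≤mirror i i<n)
    j<mirror (inj₁ h) = far-mirror i j h

  σ-comm : ∀ (i j : Fin n) p → suc (toℕ i) < toℕ j → σ i (σ j p) ≡ σ j (σ i p)
  σ-comm i j p i<j with position-cases j
  ... | inj₂ j≡n
    rewrite σ-last j p j≡n | σ-last j (σ i p) j≡n
          | σ-inner i p (<-trans i<j (toℕ<n j)) | σ-inner i (adjSwap (toℕ j) p) (<-trans i<j (toℕ<n j)) = begin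
    s i (s′ i (s j p))  ≡⟨ cong (s i) (adjSwap-comm (toℕ j) (mirror i) p (far-mirror i j i<j)) ⟨
    s i (s j (s′ i p))  ≡⟨ adjSwap-comm (toℕ i) (toℕ j) _ i<j ⟩
    s j (s i (s′ i p))  ∎
    where
    open ≡-Reasoning
    s s′ : Fin n → Fin (2 * n) → Fin (2 * n)
    s i = adjSwap (toℕ i)
    s′ i = adjSwap (mirror i)
  ... | inj₁ j<n
    rewrite σ-inner j p j<n | σ-inner j (σ i p) j<n
          | σ-inner i p (<-trans i<j (toℕ<n j)) | σ-inner i (adjSwap (toℕ j) (adjSwap (mirror j) p)) (<-trans i<j (toℕ<n j)) = begin
    s i (s′ i (s j (s′ j p)))  ≡⟨ cong (s i) (adjSwap-comm (toℕ j) (mirror i) _ (far-mirror i j i<j)) ⟨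
    s i (s j (s′ i (s′ j p)))  ≡⟨ adjSwap-comm (toℕ i) (toℕ j) _ i<j ⟩
    s j (s i (s′ i (s′ j p)))  ≡⟨ cong (s j ∘ s i) (adjSwap-comm (mirror j) (mirror i) p mirrors) ⟨
    s j (s i (s′ j (s′ i p)))  ≡⟨ cong (s j) (adjSwap-comm (toℕ i) (mirror j) _ (<-≤-trans i<n (n≤mirror j j<n))) ⟩
    s j (s′ j (s i (s′ i p)))  ∎
    where
    open ≡-Reasoning
    i<n = <-trans i<j (toℕ<n j)
    s s′ : Fin n → Fin (2 * n) → Fin (2 * n)
    s i = adjSwap (toℕ i)
    s′ i = adjSwap (mirror i)
    mirrors : suc (mirror j) < mirror i
    mirrors = +-cancelˡ-≤ (toℕ i) _ _
      (≤-trans (≤-reflexive (trans (+-suc _ _) (cong suc (+-suc _ _))))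
      (≤-trans (+-monoˡ-≤ (mirror j) i<j)
               (≤-reflexive (+-cancelˡ-≡ 2 _ _ (trans (mirror-sum j j<n) (sym (mirror-sum i i<n)))))))

  gen-comm : {i j : Fin n} → Far i j → gen n i · gen n j ≡ gen n j · gen n i
  gen-comm {i} {j} far = vec-ext λ p → trans (lookup-· (gen n i) (gen n j) p) (trans (comm far p) (sym (lookup-· (gen n j) (gen n i) p)))
    where
    comm : Far i j → ∀ p → σ i (σ j p) ≡ σ j (σ i p)
    comm (inj₁ h) p = σ-comm i j p h
    comm (inj₂ h) p = sym (σ-comm j i p h)

  gen-involutive : (i : Fin n) → gen n i · gen n i ≡ idP
  gen-involutive i = vec-ext λ p → trans (lookup-· (gen n i) (gen n i) p) (trans (σ-involutive i p) (sym (lookup-allFin p)))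

  gen-cancel : ∀ v (i : Fin n) → (v · gen n i) · gen n i ≡ v
  gen-cancel v i = trans (·-assoc v (gen n i) (gen n i)) (trans (cong (v ·_) (gen-involutive i)) (·-identityʳ v))

  -- Words

  wordPerm-[_] : (i : Fin n) → wordPerm n (i ∷ []) ≡ gen n i
  wordPerm-[ i ] = ·-identityʳ (gen n i)

  wordPerm-++ : ∀ us ws → wordPerm n (us ++ ws) ≡ wordPerm n us · wordPerm n ws
  wordPerm-++ []       ws = sym (·-identityˡ (wordPerm n ws))
  wordPerm-++ (i ∷ us) ws = trans (cong (gen n i ·_) (wordPerm-++ us ws)) (sym (·-assoc (gen n i) (wordPerm n us) (wordPerm n ws)))

  wordPerm-reverseˡ : ∀ ws → wordPerm n (reverse ws) · wordPerm n ws ≡ idP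
  wordPerm-reverseˡ []       = ·-identityˡ idP
  wordPerm-reverseˡ (i ∷ ws) = begin
    wordPerm n (reverse (i ∷ ws)) · (gen n i · wordPerm n ws)
      ≡⟨ cong (_· (gen n i · wordPerm n ws)) (trans (cong (wordPerm n) (unfold-reverse i ws)) (wordPerm-++ (reverse ws) (i ∷ []))) ⟩
    (wordPerm n (reverse ws) · wordPerm n (i ∷ [])) · (gen n i · wordPerm n ws)
      ≡⟨ cong (λ g → (wordPerm n (reverse ws) · g) · (gen n i · wordPerm n ws)) (wordPerm-[ i ]) ⟩
    (wordPerm n (reverse ws) · gen n i) · (gen n i · wordPerm n ws)
      ≡⟨ ·-assoc (wordPerm n (reverse ws) · gen n i) (gen n i) (wordPerm n ws) ⟨
    ((wordPerm n (reverse ws) · gen n i) · gen n i) · wordPerm n ws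
      ≡⟨ cong (_· wordPerm n ws) (gen-cancel (wordPerm n (reverse ws)) i) ⟩
    wordPerm n (reverse ws) · wordPerm n ws
      ≡⟨ wordPerm-reverseˡ ws ⟩
    idP ∎
    where open ≡-Reasoning

  wordPerm-reverseʳ : ∀ ws → wordPerm n ws · wordPerm n (reverse ws) ≡ idP
  wordPerm-reverseʳ ws = subst (λ us → wordPerm n us · wordPerm n (reverse ws) ≡ idP)
    (reverse-involutive ws) (wordPerm-reverseˡ (reverse ws))

  inW-id : InW n idP
  inW-id = [] , refl

  inW-gen : (i : Fin n) → InW n (gen n i)
  inW-gen i = (i ∷ []) , wordPerm-[ i ]

  inW-· : ∀ {u w} → InW n u → InW n w → InW n (u · w)
  inW-· (us , refl) (ws , refl) = (us ++ ws) , wordPerm-++ us ws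

  ·-cancelˡ : ∀ {u x y} → InW n u → u · x ≡ u · y → x ≡ y
  ·-cancelˡ {u} {x} {y} (us , refl) eq = trans (sym (strip x)) (trans (cong (wordPerm n (reverse us) ·_) eq) (strip y))
    where
    strip : ∀ z → wordPerm n (reverse us) · (u · z) ≡ z
    strip z = trans (sym (·-assoc (wordPerm n (reverse us)) (wordPerm n us) z)) (trans (cong (_· z) (wordPerm-reverseˡ us)) (·-identityˡ z))

  lookup-injective : ∀ {u} → InW n u → ∀ {p q} → lookup u p ≡ lookup u q → p ≡ q
  lookup-injective {u} (us , refl) {p} {q} eq = trans (sym (strip p)) (trans (cong (lookup (wordPerm n (reverse us))) eq) (strip q))
    where
    strip : ∀ r → lookup (wordPerm n (reverse us)) (lookup u r) ≡ r
    strip r = trans (sym (lookup-· (wordPerm n (reverse us)) (wordPerm n us) r)) (trans (cong (λ z → lookup z r) (wordPerm-reverseˡ us)) (lookup-allFin r))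

  PairwiseFar : List (Fin n) → Set
  PairwiseFar ws = ∀ {i j} → i ∈ₗ ws → j ∈ₗ ws → i ≢ j → Far i j

  wordPerm-↭ : ∀ {us ws} → us ↭ ws → PairwiseFar us → wordPerm n us ≡ wordPerm n ws
  wordPerm-↭ Perm.refl       far = refl
  wordPerm-↭ (prep i π)      far = cong (gen n i ·_) (wordPerm-↭ π λ a b → far (there a) (there b))
  wordPerm-↭ {us = _ ∷ _ ∷ us} {ws = _ ∷ _ ∷ ws} (swap i j π) far = begin
    gen n i · (gen n j · wordPerm n us)  ≡⟨ ·-assoc (gen n i) (gen n j) (wordPerm n us) ⟨
    (gen n i · gen n j) · wordPerm n us  ≡⟨ cong₂ _·_ comm (wordPerm-↭ π λ a b → far (there (there a)) (there (there b))) ⟩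
    (gen n j · gen n i) · wordPerm n ws  ≡⟨ ·-assoc (gen n j) (gen n i) (wordPerm n ws) ⟩
    gen n j · (gen n i · wordPerm n ws)  ∎
    where
    open ≡-Reasoning
    comm : gen n i · gen n j ≡ gen n j · gen n i
    comm with i ≟F j
    ... | yes refl = refl
    ... | no  i≢j  = gen-comm (far (here refl) (there (here refl)) i≢j)
  wordPerm-↭ (Perm.trans π ρ) far = trans (wordPerm-↭ π far)
    (wordPerm-↭ ρ λ a b → far (∈-resp-↭ (↭-sym π) a) (∈-resp-↭ (↭-sym π) b))

  -- Each factor preserves {0, ..., i}. Contrapositively, a permutation that moves a position out of
  -- this segment has the letter `i` in all its words.
  avoid-≤ : ∀ ws {i} → i ∉ₗ ws → ∀ p → toℕ p ≤ toℕ i → toℕ (lookup (wordPerm n ws) p) ≤ toℕ i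
  avoid-≤ []       i∉ p p≤i rewrite lookup-allFin p = p≤i
  avoid-≤ (j ∷ ws) i∉ p p≤i rewrite lookup-· (gen n j) (wordPerm n ws) p =
    σ-≤ j _ _ (λ { refl → i∉ (here refl) }) (avoid-≤ ws (i∉ ∘ there) p p≤i)

  avoid-> : ∀ ws {i} → i ∉ₗ ws → ∀ p → toℕ i < toℕ p → toℕ i < toℕ (lookup (wordPerm n ws) p)
  avoid-> []       i∉ p i<p rewrite lookup-allFin p = i<p
  avoid-> (j ∷ ws) i∉ p i<p rewrite lookup-· (gen n j) (wordPerm n ws) p =
    σ-> j _ _ (λ { refl → i∉ (here refl) }) (avoid-> ws (i∉ ∘ there) p i<p)

  lo hi : Fin n → Fin (2 * n)
  lo i = fromℕ< (<-trans (n<1+n _) (1+i<2n i))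
  hi i = fromℕ< (1+i<2n i)

  toℕ-lo : ∀ i → toℕ (lo i) ≡ toℕ i
  toℕ-lo i = toℕ-fromℕ< _

  toℕ-hi : ∀ i → toℕ (hi i) ≡ suc (toℕ i)
  toℕ-hi i = toℕ-fromℕ< _

  σ-lo≡hi : ∀ i → σ i (lo i) ≡ hi i
  σ-lo≡hi i = toℕ-injective (trans (σ-lo i (lo i) (toℕ-lo i)) (sym (toℕ-hi i)))

  σ-hi≡lo : ∀ i → σ i (hi i) ≡ lo i
  σ-hi≡lo i = toℕ-injective (trans (σ-hi i (hi i) (toℕ-hi i)) (sym (toℕ-lo i)))

  -- The witness is the preimage of `lo i` under the factors behind `i`. These avoid `i`, so the
  -- preimage stays in {0, ..., i}, and `gen n i` then carries `lo i` to `hi i`.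
  once-image : ∀ us ws {i} → i ∉ₗ ws →
               ∃ λ p → toℕ p ≤ toℕ i × lookup (wordPerm n (us ++ i ∷ ws)) p ≡ lookup (wordPerm n us) (hi i)
  once-image us ws {i} i∉ws = p , avoid-≤ (reverse ws) (i∉ws ∘ reverse⁻) (lo i) (≤-reflexive (toℕ-lo i)) , (begin
      lookup (wordPerm n (us ++ i ∷ ws)) p
        ≡⟨ cong (λ z → lookup z p) (wordPerm-++ us (i ∷ ws)) ⟩
      lookup (wordPerm n us · (gen n i · wordPerm n ws)) p
        ≡⟨ trans (lookup-· (wordPerm n us) (gen n i · wordPerm n ws) p) (cong (lookup (wordPerm n us)) (lookup-· (gen n i) (wordPerm n ws) p)) ⟩
      lookup (wordPerm n us) (σ i (lookup (wordPerm n ws) p))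
        ≡⟨ cong (lookup (wordPerm n us) ∘ σ i) (trans (sym (lookup-· (wordPerm n ws) (wordPerm n (reverse ws)) (lo i)))
             (trans (cong (λ z → lookup z (lo i)) (wordPerm-reverseʳ ws)) (lookup-allFin _))) ⟩
      lookup (wordPerm n us) (σ i (lo i))
        ≡⟨ cong (lookup (wordPerm n us)) (σ-lo≡hi i) ⟩
      lookup (wordPerm n us) (hi i) ∎)
    where
    open ≡-Reasoning
    p = lookup (wordPerm n (reverse ws)) (lo i)

  -- A converse to `avoid-≤` for a single occurrence: the letter pushes a position across the
  -- boundary, and the remaining factors cannot bring it back.
  once-moves : ∀ us ws {i} → i ∉ₗ us → i ∉ₗ ws →
               ∃ λ p → toℕ p ≤ toℕ i × toℕ i < toℕ (lookup (wordPerm n (us ++ i ∷ ws)) p)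
  once-moves us ws {i} i∉us i∉ws with p , p≤i , eq ← once-image us ws i∉ws = p , p≤i ,
    subst (λ q → toℕ i < toℕ q) (sym eq) (avoid-> us i∉us (hi i) (≤-reflexive (sym (toℕ-hi i))))

  -- Symmetric permutations and the length statistic

  Symmetric : Perm (2 * n) → Set
  Symmetric v = ∀ p → lookup v (opposite p) ≡ opposite (lookup v p)

  symmetric-·gen : ∀ v i → Symmetric v → Symmetric (v · gen n i)
  symmetric-·gen v i sv p rewrite lookup-· v (gen n i) p | lookup-· v (gen n i) (opposite p) | σ-opposite i p = sv _

  symmetric-word : ∀ ws v → Symmetric v → Symmetric (v · wordPerm n ws)
  symmetric-word []       v sv rewrite ·-identityʳ v = sv
  symmetric-word (i ∷ ws) v sv rewrite sym (·-assoc v (gen n i) (wordPerm n ws)) =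
    symmetric-word ws (v · gen n i) (symmetric-·gen v i sv)

  inW-symmetric : ∀ {v} → InW n v → Symmetric v
  inW-symmetric (ws , refl) = subst Symmetric (·-identityˡ (wordPerm n ws)) (symmetric-word ws idP λ p →
    trans (lookup-allFin (opposite p)) (cong opposite (sym (lookup-allFin p))))

  -- Twice the Coxeter length: a generator s_i with i < n changes two inversions of the
  -- permutation of [2n], while s_n changes one inversion and one entry of the left half exceeding n.
  M : Perm (2 * n) → ℕ
  M v = inv v + upper n n v

  Asc Dsc : Perm (2 * n) → Fin n → Set
  Asc v i = toℕ (lookup v (lo i)) < toℕ (lookup v (hi i))
  Dsc v i = toℕ (lookup v (hi i)) < toℕ (lookup v (lo i))

  lookup-swapAt-right : ∀ a (v : Perm m) q → suc a < toℕ q → lookup (swapAt a v) q ≡ lookup v q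
  lookup-swapAt-right a v q a<q = trans (lookup-swapAt a v q)
    (cong (lookup v) (adjSwap-fix a q (<⇒≢ (<-trans (n<1+n _) a<q) ∘ sym) (<⇒≢ a<q ∘ sym)))

  M-asc : ∀ v i → Symmetric v → Asc v i → M (v · gen n i) ≡ 2 + M v
  M-asc v i sv asc with position-cases i
  ... | inj₂ i≡n = begin
      M (v · gen n i)
        ≡⟨ cong M v·gen ⟩
      inv (swapAt (toℕ i) v) + upper n n (swapAt (toℕ i) v)
        ≡⟨ cong₂ _+_ (inv-swapAt (toℕ i) v (lo i) (hi i) (toℕ-lo i) (toℕ-hi i) asc)
             (subst (λ r → upper n r (swapAt (toℕ i) v) ≡ suc (upper n r v)) i≡n
               (upper-swapAt-cross n (toℕ i) v (lo i) (hi i) (toℕ-lo i) (toℕ-hi i) a<n n≤b)) ⟩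
      suc (inv v) + suc (upper n n v)
        ≡⟨ cong suc (+-suc (inv v) _) ⟩
      2 + M v ∎
    where
    open ≡-Reasoning
    a b : ℕ
    a = toℕ (lookup v (lo i))
    b = toℕ (lookup v (hi i))
    v·gen : v · gen n i ≡ swapAt (toℕ i) v
    v·gen = vec-ext λ p → trans (lookup-· v (gen n i) p) (trans (cong (lookup v) (σ-last i p i≡n)) (sym (lookup-swapAt (toℕ i) v p)))
    mid : opposite (lo i) ≡ hi i
    mid = opposite-unique (lo i) (hi i) (trans (cong₂ (λ x y → suc x + y) (toℕ-lo i) (toℕ-hi i))
      (trans (cong₂ _+_ i≡n i≡n) (sym (2n≡n+n))))
    -- For the last generator `lo i` and `hi i` are mirror images, so their entries add up to 2n -
    -- 1. An ascent therefore puts them on the two sides of the middle.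
    a+b : suc a + b ≡ n + n
    a+b = trans (cong (λ x → suc a + toℕ x) (trans (cong (lookup v) (sym mid)) (sv (lo i))))
      (trans (opposite-sum (lookup v (lo i))) (2n≡n+n))
    a<n : a < n
    a<n = ≰⇒> λ n≤a → <-irrefl (sym a+b) (s≤s (+-mono-≤ n≤a (≤-trans n≤a (<⇒≤ asc))))
    n≤b : n ≤ b
    n≤b = ≮⇒≥ λ b<n → <-irrefl a+b (+-mono-≤-< (≤-trans asc (<⇒≤ b<n)) b<n)
  ... | inj₁ i<n = begin
      M (v · gen n i)
        ≡⟨ cong M v·gen ⟩
      inv (swapAt (mirror i) w) + upper n n (swapAt (mirror i) w)
        ≡⟨ cong₂ _+_ (inv-swapAt (mirror i) w (opposite (hi i)) (opposite (lo i)) opp-hi opp-lo w-asc)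
                     (upper-swapAt-right n n (mirror i) w (n≤mirror i i<n)) ⟩
      suc (inv w) + upper n n w
        ≡⟨ cong₂ (λ x y → suc x + y) (inv-swapAt (toℕ i) v (lo i) (hi i) (toℕ-lo i) (toℕ-hi i) asc)
                     (upper-swapAt-left n n (toℕ i) v i<n) ⟩
      2 + M v ∎
    where
    open ≡-Reasoning
    w = swapAt (toℕ i) v
    v·gen : v · gen n i ≡ swapAt (mirror i) w
    v·gen = vec-ext λ p → trans (lookup-· v (gen n i) p) (trans (cong (lookup v) (σ-inner i p i<n))
      (sym (trans (lookup-swapAt (mirror i) w p) (lookup-swapAt (toℕ i) v _))))
    opp-hi : toℕ (opposite (hi i)) ≡ mirror i
    opp-hi = +-cancelˡ-≡ (2 + toℕ i) _ _ (trans (cong (λ x → suc x + toℕ (opposite (hi i))) (sym (toℕ-hi i)))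
      (trans (opposite-sum (hi i)) (sym (mirror-sum i i<n))))
    opp-lo : toℕ (opposite (lo i)) ≡ suc (mirror i)
    opp-lo = +-cancelˡ-≡ (1 + toℕ i) _ _ (trans (cong (λ x → suc x + toℕ (opposite (lo i))) (sym (toℕ-lo i)))
      (trans (opposite-sum (lo i)) (trans (sym (mirror-sum i i<n)) (cong suc (sym (+-suc (toℕ i) (mirror i)))))))
    w-opp : ∀ q → suc (toℕ i) < toℕ (opposite q) → lookup w (opposite q) ≡ opposite (lookup v q)
    w-opp q lt = trans (lookup-swapAt-right (toℕ i) v _ lt) (sv q)
    -- The second swap exchanges the mirror images of the first pair. The first swap leaves them
    -- untouched, and symmetry turns the ascent of `v` at `i` into an ascent there.
    w-asc : toℕ (lookup w (opposite (hi i))) < toℕ (lookup w (opposite (lo i)))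
    w-asc rewrite w-opp (hi i) (subst (suc (toℕ i) <_) (sym opp-hi) (i<mirror i i<n))
                | w-opp (lo i) (subst (suc (toℕ i) <_) (sym opp-lo) (m≤n⇒m≤1+n (i<mirror i i<n))) =
      opposite-mono-< _ _ asc

  asc-·gen : ∀ v i → Dsc v i → Asc (v · gen n i) i
  asc-·gen v i d rewrite lookup-· v (gen n i) (lo i) | lookup-· v (gen n i) (hi i) | σ-lo≡hi i | σ-hi≡lo i = d

  dsc-·gen : ∀ v i → Asc v i → Dsc (v · gen n i) i
  dsc-·gen v i d rewrite lookup-· v (gen n i) (lo i) | lookup-· v (gen n i) (hi i) | σ-lo≡hi i | σ-hi≡lo i = d

  M-dsc : ∀ v i → Symmetric v → Dsc v i → M v ≡ 2 + M (v · gen n i)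
  M-dsc v i sv d = trans (cong M (sym (gen-cancel v i))) (M-asc (v · gen n i) i (symmetric-·gen v i sv) (asc-·gen v i d))

  asc? : ∀ v i → Dec (Asc v i)
  asc? v i = toℕ (lookup v (lo i)) <? toℕ (lookup v (hi i))

  ¬asc⇒dsc : ∀ {v} → InW n v → ∀ i → ¬ Asc v i → Dsc v i
  ¬asc⇒dsc {v} v∈W i ¬asc with <-cmp (toℕ (lookup v (lo i))) (toℕ (lookup v (hi i)))
  ... | tri< a _ _ = contradiction a ¬asc
  ... | tri> _ _ d = d
  ... | tri≈ _ e _ = contradiction
    (trans (sym (toℕ-lo i)) (trans (cong toℕ (lookup-injective v∈W (toℕ-injective e))) (toℕ-hi i))) (<⇒≢ (n<1+n _))

  M-gen-≤ : ∀ {v} → InW n v → ∀ i → M (v · gen n i) ≤ 2 + M v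
  M-gen-≤ {v} v∈W i with asc? v i
  ... | yes asc = ≤-reflexive (M-asc v i (inW-symmetric v∈W) asc)
  ... | no ¬asc = ≤-trans (≤-trans (m≤n+m _ 2) (≤-reflexive (sym (M-dsc v i (inW-symmetric v∈W) (¬asc⇒dsc v∈W i ¬asc))))) (m≤n+m _ 2)

  M-word-≤ : ∀ ws {v} → InW n v → M (v · wordPerm n ws) ≤ M v + length ws * 2
  M-word-≤ []       {v} v∈W rewrite ·-identityʳ v = m≤m+n _ 0
  M-word-≤ (i ∷ ws) {v} v∈W = begin
    M (v · (gen n i · wordPerm n ws))    ≡⟨ cong M (·-assoc v (gen n i) (wordPerm n ws)) ⟨
    M ((v · gen n i) · wordPerm n ws)    ≤⟨ M-word-≤ ws (inW-· v∈W (inW-gen i)) ⟩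
    M (v · gen n i) + length ws * 2      ≤⟨ +-monoˡ-≤ _ (M-gen-≤ v∈W i) ⟩
    2 + M v + length ws * 2              ≡⟨ trans (+-suc (M v) _) (cong suc (+-suc (M v) _)) ⟨
    M v + (2 + length ws * 2)            ∎
    where open ≤-Reasoning

  M-id : M idP ≡ 0
  M-id = cong₂ _+_ (inv-sorted idP λ p q p<q → subst₂ _≤_ (e p) (e q) (<⇒≤ p<q))
                   (upper-none n n idP λ p p<n → subst (_< n) (e p) p<n)
    where
    e : (p : Fin (2 * n)) → toℕ p ≡ toℕ (lookup idP p)
    e p = cong toℕ (sym (lookup-allFin p))

  wordPerm-M-≤ : ∀ ws → M (wordPerm n ws) ≤ length ws * 2
  wordPerm-M-≤ ws = subst₂ (λ x y → M x ≤ y + length ws * 2) (·-identityˡ (wordPerm n ws)) M-id (M-word-≤ ws inW-id)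

  -- Reduced words and the Coxeter length

  module _ {v} (v∈W : InW n v) (asc : ∀ i → Asc v i) where

    private
      sv = inW-symmetric v∈W

    ascending : ∀ p q → toℕ q ≡ suc (toℕ p) → toℕ (lookup v p) < toℕ (lookup v q)
    ascending p q eq with toℕ p <? n
    ... | yes p<n = subst₂ (λ x y → toℕ (lookup v x) < toℕ (lookup v y))
      (toℕ-injective (trans (toℕ-lo i) (toℕ-fromℕ< p<n)))
      (toℕ-injective (trans (toℕ-hi i) (trans (cong suc (toℕ-fromℕ< p<n)) (sym eq)))) (asc i)
      where i = fromℕ< p<n
    -- In the right half the pair is mirrored to the left half, where the hypothesis on ascents
    -- applies.
    ... | no p≮n = opposite-cancel-< _ _ (subst₂ (λ x y → toℕ x < toℕ y) (sv q) (sv p)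
        (subst₂ (λ x y → toℕ (lookup v x) < toℕ (lookup v y))
          (toℕ-injective (trans (toℕ-lo i) (toℕ-fromℕ< q′<n)))
          (toℕ-injective (trans (toℕ-hi i) (trans (cong suc (toℕ-fromℕ< q′<n)) (sym opp)))) (asc i)))
      where
      opp : toℕ (opposite p) ≡ suc (toℕ (opposite q))
      opp = +-cancelˡ-≡ (suc (toℕ p)) _ _ (trans (opposite-sum p) (trans (sym (opposite-sum q))
        (trans (cong (λ x → suc x + toℕ (opposite q)) eq) (cong suc (sym (+-suc (toℕ p) _))))))
      q′<n : toℕ (opposite q) < n
      q′<n = +-cancelˡ-≤ n _ _ (begin
        n + suc (toℕ (opposite q))         ≤⟨ +-monoˡ-≤ _ (≮⇒≥ p≮n) ⟩
        toℕ p + suc (toℕ (opposite q))     ≤⟨ n≤1+n _ ⟩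
        suc (toℕ p) + suc (toℕ (opposite q)) ≡⟨ cong (suc (toℕ p) +_) opp ⟨
        suc (toℕ p) + toℕ (opposite p)     ≡⟨ opposite-sum p ⟩
        2 * n                              ≡⟨ 2n≡n+n ⟩
        n + n                              ∎)
        where open ≤-Reasoning
      i = fromℕ< q′<n

    ≤-lookup : ∀ a p → toℕ p ≡ a → a ≤ toℕ (lookup v p)
    ≤-lookup zero    p _  = z≤n
    ≤-lookup (suc a) p eq = ≤-<-trans (≤-lookup a r (toℕ-fromℕ< _)) (ascending r p (trans eq (cong suc (sym (toℕ-fromℕ< _)))))
      where r = fromℕ< (<-trans (n<1+n a) (subst (_< 2 * n) eq (toℕ<n p)))

    -- An increasing permutation lies weakly above the identity. An entry strictly above its
    -- position would have a mirror image strictly below its own, so equality holds everywhere.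
    no-descents⇒id : v ≡ idP
    no-descents⇒id = vec-ext λ p → trans (toℕ-injective (≤-antisym
      (≮⇒≥ λ p<vp → <⇒≱ (subst (λ x → toℕ x < toℕ (opposite p)) (sym (sv p)) (opposite-mono-< _ _ p<vp)) (≤-lookup _ (opposite p) refl))
      (≤-lookup _ p refl))) (sym (lookup-allFin p))

  -- Stripping a descent lowers `M` by exactly 2, and the process stops only at the identity. The
  -- bound `b` serves as fuel for the recursion.
  reduced-word : ∀ b {v} → InW n v → M v ≤ b → ∃ λ ws → wordPerm n ws ≡ v × M v ≡ length ws * 2
  reduced-word b {v} v∈W Mv≤b with any? (λ i → toℕ (lookup v (hi i)) <? toℕ (lookup v (lo i)))
  ... | no ¬d = [] , sym v≡id , trans (cong M v≡id) M-id
    where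
    v≡id : v ≡ idP
    v≡id = no-descents⇒id v∈W λ i → [ id , (λ ¬asc → contradiction (i , ¬asc⇒dsc v∈W i ¬asc) ¬d) ]′ (toSum (asc? v i))
  ... | yes (i , d) with eq ← M-dsc v i (inW-symmetric v∈W) d with b
  ...   | zero = contradiction (trans (sym eq) (n≤0⇒n≡0 Mv≤b)) λ ()
  ...   | suc b′ with ws , ws≡ , Mws ← reduced-word b′ (inW-· v∈W (inW-gen i))
                        (≤-trans (n≤1+n _) (s≤s⁻¹ (≤-trans (≤-reflexive (sym eq)) Mv≤b))) =
    ws ++ i ∷ [] ,
    trans (wordPerm-++ ws (i ∷ [])) (trans (cong₂ _·_ ws≡ wordPerm-[ i ]) (gen-cancel v i)) ,
    trans eq (trans (cong (2 +_) Mws) (cong (_* 2) (sym (trans (length-++ ws) (+-comm (length ws) 1)))))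

  reduced : ∀ {v} → InW n v → ∃ λ ws → wordPerm n ws ≡ v × M v ≡ length ws * 2
  reduced v∈W = reduced-word _ v∈W ≤-refl

  len⇒M : ∀ {v l} → Len n v l → M v ≡ l * 2
  len⇒M {v} ((us , refl , refl) , minimal) with ws , ws≡ , Mv ← reduced (us , refl) =
    ≤-antisym (wordPerm-M-≤ us) (≤-trans (*-monoˡ-≤ 2 (minimal ws ws≡)) (≤-reflexive (sym Mv)))

  M⇒len : ∀ {v l} → InW n v → M v ≡ l * 2 → Len n v l
  M⇒len {v} {l} v∈W Mv with ws , ws≡ , Mws ← reduced v∈W =
    (ws , *-cancelʳ-≡ _ _ 2 (trans (sym Mws) Mv) , ws≡) ,
    λ { us refl → *-cancelʳ-≤ l _ 2 (≤-trans (≤-reflexive (sym Mv)) (wordPerm-M-≤ us)) }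

  len : ∀ {v} → InW n v → ∃ λ l → Len n v l × M v ≡ l * 2
  len v∈W with ws , _ , Mv ← reduced v∈W = length ws , M⇒len v∈W Mv , Mv

  -- Descents and the weak order in terms of `M`

  asc⇒¬Des : ∀ {v} → InW n v → ∀ i → Asc v i → ¬ Des n v i
  asc⇒¬Des {v} v∈W i asc (l , l′ , lenv , lenv′ , l′<l) = <⇒≱ (*-monoˡ-< 2 l′<l)
    (subst₂ _≤_ (len⇒M lenv) (trans (sym (M-asc v i (inW-symmetric v∈W) asc)) (len⇒M lenv′)) (m≤n+m _ 2))

  ¬Des⇒asc : ∀ {v} → InW n v → ∀ i → ¬ Des n v i → Asc v i
  ¬Des⇒asc {v} v∈W i ¬des with asc? v i
  ... | yes asc = asc
  ... | no ¬asc with l , lenv , Mv ← len v∈W | l′ , lenv′ , Mv′ ← len (inW-· v∈W (inW-gen i)) =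
    contradiction (l , l′ , lenv , lenv′ , *-cancelʳ-< 2 l′ l
      (subst₂ _<_ Mv′ (trans (sym (M-dsc v i (inW-symmetric v∈W) (¬asc⇒dsc v∈W i ¬asc))) Mv) (m≤n+m _ 1))) ¬des

  -- The right weak order again, with `M` in place of lengths and membership in the group made
  -- explicit, so that additivity becomes plain arithmetic.
  record _≤W_ (u w : Perm (2 * n)) : Set where
    constructor mk
    field
      {quot} : Perm (2 * n)
      u∈W    : InW n u
      quot∈W : InW n quot
      u·quot : u · quot ≡ w
      M-add  : M w ≡ M u + M quot

  WLe⇒≤W : ∀ {u w} → WLe n u w → u ≤W w
  WLe⇒≤W (x , u·x , lu , lx , lw , lenu@((us , _ , us≡) , _) , lenx@((xs , _ , xs≡) , _) , lenw , eq) =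
    mk (us , us≡) (xs , xs≡) u·x
      (trans (len⇒M lenw) (trans (cong (_* 2) eq) (trans (*-distribʳ-+ 2 lu lx) (sym (cong₂ _+_ (len⇒M lenu) (len⇒M lenx))))))

  ≤W⇒WLe : ∀ {u w} → u ≤W w → WLe n u w
  ≤W⇒WLe (mk {x} u∈W x∈W refl eq)
    with lu , lenu , Mu ← len u∈W | lx , lenx , Mx ← len x∈W =
    x , refl , lu , lx , lu + lx , lenu , lenx ,
    M⇒len (inW-· u∈W x∈W) (trans eq (trans (cong₂ _+_ Mu Mx) (sym (*-distribʳ-+ 2 lu lx)))) , refl

  independent-far : ∀ {T : Subset n} → Independent T → PairwiseFar (elems T)
  independent-far ind {i} {j} i∈ j∈ i≢j with <-cmp (toℕ i) (toℕ j)
  ... | tri< i<j _ _ = inj₁ (≤∧≢⇒< i<j (ind (∈-elems⁻ i∈) (∈-elems⁻ j∈) ∘ sym))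
  ... | tri≈ _ e _   = contradiction (toℕ-injective e) i≢j
  ... | tri> _ _ j<i = inj₂ (≤∧≢⇒< j<i (ind (∈-elems⁻ j∈) (∈-elems⁻ i∈) ∘ sym))

  -- A word for a product of distinct letters uses all of them, so a word that is no longer uses each once.
  shortest-↭ : ∀ {ts ws} → Unique ts → wordPerm n ws ≡ wordPerm n ts → length ws ≤ length ts → ws ↭ ts
  shortest-↭ {ts} {ws} u eq le = ⊆-length⇒↭ u support le
    where
    support : ∀ {i} → i ∈ₗ ts → i ∈ₗ ws
    support {i} i∈ts with i ∈ₗ? ws
    ... | yes i∈ws = i∈ws
    ... | no  i∉ws with us , vs , refl , i∉us , i∉vs ← unique-split u i∈ts
                   with p , p≤i , i<p ← once-moves us vs i∉us i∉vs =
      contradiction (subst (λ x → toℕ (lookup x p) ≤ toℕ i) eq (avoid-≤ ws i∉ws p p≤i)) (<⇒≱ i<p)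

  ·-++ : ∀ v us ws → v · wordPerm n (us ++ ws) ≡ (v · wordPerm n us) · wordPerm n ws
  ·-++ v us ws = trans (cong (v ·_) (wordPerm-++ us ws)) (sym (·-assoc v (wordPerm n us) (wordPerm n ws)))

  inW-word : ∀ {v} ws → InW n v → InW n (v · wordPerm n ws)
  inW-word ws v∈W = inW-· v∈W (ws , refl)

  M-subadditive : ∀ {u x} → InW n u → InW n x → M (u · x) ≤ M u + M x
  M-subadditive {u} u∈W x∈W with ws , refl , Mx ← reduced x∈W =
    ≤-trans (M-word-≤ ws u∈W) (≤-reflexive (cong (M u +_) (sym Mx)))

  -- Subadditivity and the bound by word length squeeze `M (wordPerm n ws)`: a word that attains the
  -- largest possible growth is reduced.
  ≤W-intro : ∀ {u} ws → InW n u → M (u · wordPerm n ws) ≡ M u + length ws * 2 → u ≤W (u · wordPerm n ws)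
  ≤W-intro {u} ws u∈W eq = mk u∈W (ws , refl) refl (≤-antisym (M-subadditive u∈W (ws , refl))
    (≤-trans (+-monoʳ-≤ (M u) (wordPerm-M-≤ ws)) (≤-reflexive (sym eq))))

  ≤W-trans : ∀ {u a w} → u ≤W a → a ≤W w → u ≤W w
  ≤W-trans {u} (mk {y} u∈W y∈W refl Ma) (mk {z} a∈W z∈W refl Mw) =
    mk u∈W (inW-· y∈W z∈W) (sym (·-assoc u y z)) (≤-antisym
      (≤-trans (≤-reflexive (cong M (·-assoc u y z))) (M-subadditive u∈W (inW-· y∈W z∈W)))
      (begin
        M u + M (y · z)      ≤⟨ +-monoʳ-≤ (M u) (M-subadditive y∈W z∈W) ⟩
        M u + (M y + M z)    ≡⟨ +-assoc (M u) (M y) (M z) ⟨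
        M u + M y + M z      ≡⟨ cong (_+ M z) Ma ⟨
        M (u · y) + M z      ≡⟨ Mw ⟨
        M ((u · y) · z)      ∎))
    where open ≤-Reasoning

  M-mono : ∀ {u w} → u ≤W w → M u ≤ M w
  M-mono {u} (mk {x} _ _ _ Mw) = ≤-trans (m≤m+n (M u) (M x)) (≤-reflexive (sym Mw))

  -- Neither piece can grow `M` by more than twice its length, so if the whole word attains the
  -- bound, both pieces do.
  geodesic : ∀ {v} us ws → InW n v → M (v · wordPerm n (us ++ ws)) ≡ M v + length (us ++ ws) * 2 →
             M (v · wordPerm n us) ≡ M v + length us * 2 ×
             M ((v · wordPerm n us) · wordPerm n ws) ≡ M (v · wordPerm n us) + length ws * 2
  geodesic {v} us ws v∈W eq = Mus , trans total (cong (_+ length ws * 2) (sym Mus))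
    where
    total : M ((v · wordPerm n us) · wordPerm n ws) ≡ M v + length us * 2 + length ws * 2
    total = trans (cong M (sym (·-++ v us ws))) (trans eq (trans (cong (λ l → M v + l * 2) (length-++ us))
      (trans (cong (M v +_) (*-distribʳ-+ 2 (length us) (length ws))) (sym (+-assoc (M v) _ _)))))
    Mus : M (v · wordPerm n us) ≡ M v + length us * 2
    Mus = ≤-antisym (M-word-≤ us v∈W)
      (+-cancelʳ-≤ (length ws * 2) _ _ (≤-trans (≤-reflexive (sym total)) (M-word-≤ ws (inW-word us v∈W))))

  geodesic-≤W : ∀ {v} us ws → InW n v → M (v · wordPerm n (us ++ ws)) ≡ M v + length (us ++ ws) * 2 →
                v ≤W (v · wordPerm n us) × (v · wordPerm n us) ≤W (v · wordPerm n (us ++ ws))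
  geodesic-≤W {v} us ws v∈W eq with e₁ , e₂ ← geodesic us ws v∈W eq =
    ≤W-intro us v∈W e₁ , subst ((v · wordPerm n us) ≤W_) (sym (·-++ v us ws)) (≤W-intro ws (inW-word us v∈W) e₂)

  -- Products of pairwise far ascents

  lookup-far : ∀ v {i j : Fin n} p → Far i j → toℕ p ≡ toℕ j ⊎ toℕ p ≡ suc (toℕ j) → lookup (v · gen n i) p ≡ lookup v p
  lookup-far v {i} {j} p far p∈ = trans (lookup-· v (gen n i) p) (cong (lookup v) (σ-far i j p far p∈))

  asc-far : ∀ v {i j : Fin n} → Far i j → Asc v j → Asc (v · gen n i) j
  asc-far v {i} {j} far asc
    rewrite lookup-far v (lo j) far (inj₁ (toℕ-lo j)) | lookup-far v (hi j) far (inj₂ (toℕ-hi j)) = asc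

  dsc-far : ∀ v {i j : Fin n} → Far i j → Dsc v j → Dsc (v · gen n i) j
  dsc-far v {i} {j} far dsc
    rewrite lookup-far v (lo j) far (inj₁ (toℕ-lo j)) | lookup-far v (hi j) far (inj₂ (toℕ-hi j)) = dsc

  asc-word : ∀ v ws {j} → (∀ {i} → i ∈ₗ ws → Far i j) → Asc v j → Asc (v · wordPerm n ws) j
  asc-word v []       far asc rewrite ·-identityʳ v = asc
  asc-word v (i ∷ ws) far asc rewrite sym (·-assoc v (gen n i) (wordPerm n ws)) =
    asc-word (v · gen n i) ws (far ∘ there) (asc-far v (far (here refl)) asc)

  dsc-word : ∀ v ws {j} → (∀ {i} → i ∈ₗ ws → Far i j) → Dsc v j → Dsc (v · wordPerm n ws) j
  dsc-word v []       far dsc rewrite ·-identityʳ v = dsc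
  dsc-word v (i ∷ ws) far dsc rewrite sym (·-assoc v (gen n i) (wordPerm n ws)) =
    dsc-word (v · gen n i) ws (far ∘ there) (dsc-far v (far (here refl)) dsc)

  record Commuting (v : Perm (2 * n)) (ts : List (Fin n)) : Set where
    field
      letters-unique : Unique ts
      letters-far    : PairwiseFar ts
      letters-asc    : ∀ {i} → i ∈ₗ ts → Asc v i
  open Commuting

  commuting-tail : ∀ {v i ts} → Commuting v (i ∷ ts) → Commuting (v · gen n i) ts
  commuting-tail {v} {i} {ts} c with i∉ ∷ u ← letters-unique c = record
    { letters-unique = u
    ; letters-far    = λ a b → letters-far c (there a) (there b)
    ; letters-asc    = λ j∈ → asc-far v (letters-far c (here refl) (there j∈) (All.lookup i∉ j∈)) (letters-asc c (there j∈)) }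

  commuting-⊆ : ∀ {v us ts} → Unique us → (∀ {i} → i ∈ₗ us → i ∈ₗ ts) → Commuting v ts → Commuting v us
  commuting-⊆ u us⊆ts c = record
    { letters-unique = u ; letters-far = λ a b → letters-far c (us⊆ts a) (us⊆ts b) ; letters-asc = letters-asc c ∘ us⊆ts }

  M-commuting : ∀ {v} ts → InW n v → Commuting v ts → M (v · wordPerm n ts) ≡ M v + length ts * 2
  M-commuting {v} []       v∈W c rewrite ·-identityʳ v = sym (+-identityʳ (M v))
  M-commuting {v} (i ∷ ts) v∈W c = begin
    M (v · (gen n i · wordPerm n ts))    ≡⟨ cong M (·-assoc v (gen n i) (wordPerm n ts)) ⟨
    M ((v · gen n i) · wordPerm n ts)    ≡⟨ M-commuting ts (inW-· v∈W (inW-gen i)) (commuting-tail c) ⟩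
    M (v · gen n i) + length ts * 2      ≡⟨ cong (_+ length ts * 2) (M-asc v i (inW-symmetric v∈W) (letters-asc c (here refl))) ⟩
    2 + M v + length ts * 2              ≡⟨ trans (+-suc (M v) _) (cong suc (+-suc (M v) _)) ⟨
    M v + (2 + length ts * 2)            ∎
    where open ≡-Reasoning

  -- Applied to a subset K of a commuting set T, this and `commuting-asc` recover K from v·w_K: the
  -- letters of K have become descents and the other letters of T are still ascents.
  commuting-dsc : ∀ {v ts j} → Commuting v ts → j ∈ₗ ts → Dsc (v · wordPerm n ts) j
  commuting-dsc {v} {i ∷ ts} c (here refl) with i∉ ∷ _ ← letters-unique c
    rewrite sym (·-assoc v (gen n i) (wordPerm n ts)) =
    dsc-word (v · gen n i) ts (λ k∈ → letters-far c (there k∈) (here refl) (All.lookup i∉ k∈ ∘ sym)) (dsc-·gen v i (letters-asc c (here refl)))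
  commuting-dsc {v} {i ∷ ts} c (there j∈) rewrite sym (·-assoc v (gen n i) (wordPerm n ts)) =
    commuting-dsc (commuting-tail c) j∈

  commuting-asc : ∀ {v us ts j} → Commuting v ts → (∀ {i} → i ∈ₗ us → i ∈ₗ ts) → j ∈ₗ ts → j ∉ₗ us → Asc (v · wordPerm n us) j
  commuting-asc {v} {us} c us⊆ts j∈ j∉ =
    asc-word v us (λ i∈ → letters-far c (us⊆ts i∈) j∈ (λ { refl → j∉ i∈ })) (letters-asc c j∈)

  commuting-cong : ∀ {v us ts} → Commuting v ts → Unique us → (∀ {i} → i ∈ₗ us → i ∈ₗ ts) → (∀ {i} → i ∈ₗ ts → i ∈ₗ us) →
                   wordPerm n us ≡ wordPerm n ts
  commuting-cong c u us⊆ts ts⊆us = sym (wordPerm-↭ (set-↭ (letters-unique c) u ts⊆us us⊆ts) (letters-far c))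

  module _ {v} (v∈W : InW n v) where

    -- Commutation allows `ts` to be rearranged so that `us` is a prefix, and prefixes of geodesics
    -- lie below their ends.
    commuting-≤W⁺ : ∀ {us ts} → Commuting v ts → Unique us → (∀ {i} → i ∈ₗ us → i ∈ₗ ts) →
                    (v · wordPerm n us) ≤W (v · wordPerm n ts)
    commuting-≤W⁺ {us} {ts} c u us⊆ts with zs , π ← ⊆⇒↭-++ u us⊆ts =
      subst (λ x → (v · wordPerm n us) ≤W (v · x)) (sym ts≡)
        (proj₂ (geodesic-≤W us zs v∈W (subst₂ (λ x l → M (v · x) ≡ M v + l * 2) ts≡ (↭-length π) (M-commuting ts v∈W c))))
      where
      ts≡ : wordPerm n ts ≡ wordPerm n (us ++ zs)
      ts≡ = wordPerm-↭ π (letters-far c)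

    -- Appending a reduced word of the quotient to `us` gives a word for the product of `ts` of the
    -- same length as `ts`; after cancelling `v`, `shortest-↭` makes it a rearrangement.
    quotient-word : ∀ {us ts} → M (v · wordPerm n us) ≡ M v + length us * 2 → Commuting v ts →
                    (v · wordPerm n us) ≤W (v · wordPerm n ts) → ∃ λ zs → us ++ zs ↭ ts
    quotient-word {us} {ts} Mu c (mk _ z∈W eq Mt) with zs , refl , Mz ← reduced z∈W =
      zs , shortest-↭ (letters-unique c) (·-cancelˡ v∈W (trans (·-++ v us zs) eq)) (*-cancelʳ-≤ _ _ 2 (≤-reflexive len-eq))
      where
      open ≡-Reasoning
      len-eq : length (us ++ zs) * 2 ≡ length ts * 2
      len-eq = +-cancelˡ-≡ (M v) _ _ (begin
        M v + length (us ++ zs) * 2                ≡⟨ cong (λ l → M v + l * 2) (length-++ us) ⟩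
        M v + (length us + length zs) * 2          ≡⟨ cong (M v +_) (*-distribʳ-+ 2 (length us) (length zs)) ⟩
        M v + (length us * 2 + length zs * 2)      ≡⟨ +-assoc (M v) _ _ ⟨
        M v + length us * 2 + length zs * 2        ≡⟨ cong₂ _+_ Mu Mz ⟨
        M (v · wordPerm n us) + M (wordPerm n zs)  ≡⟨ Mt ⟨
        M (v · wordPerm n ts)                      ≡⟨ M-commuting ts v∈W c ⟩
        M v + length ts * 2                        ∎)

    commuting-≤W⁻ : ∀ {us ts} → Commuting v us → Commuting v ts → (v · wordPerm n us) ≤W (v · wordPerm n ts) →
                    ∀ {i} → i ∈ₗ us → i ∈ₗ ts
    commuting-≤W⁻ {us} cu ct le i∈us with zs , π ← quotient-word (M-commuting us v∈W cu) ct le = ∈-resp-↭ π (∈-++⁺ˡ i∈us)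

    between : ∀ {ts u} → Commuting v ts → v ≤W u → u ≤W (v · wordPerm n ts) →
              ∃ λ us → Unique us × (∀ {i} → i ∈ₗ us → i ∈ₗ ts) × u ≡ v · wordPerm n us
    between c (mk _ x∈W refl Mu) u≤w with xs , refl , Mx ← reduced x∈W
      with zs , π ← quotient-word (trans Mu (cong (M v +_) Mx)) c u≤w =
      xs , unique-++⁻ˡ xs (unique-↭ (↭-sym π) (letters-unique c)) , ∈-resp-↭ π ∘ ∈-++⁺ˡ , refl

    commuting⇒boolean : ∀ {ts} → Commuting v ts → IsBooleanInterval n v (v · wordPerm n ts)
    commuting⇒boolean {ts} c =
      ≤W⇒WLe v≤w , length ts , f , g , g-in , f∘g ,
      (λ u (v≤u , u≤w) → g∘f u (WLe⇒≤W v≤u) (WLe⇒≤W u≤w)) ,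
      (λ u u′ (v≤u , u≤w) (v≤u′ , u′≤w) →
        order u u′ (g∘f u (WLe⇒≤W v≤u) (WLe⇒≤W u≤w)) (g∘f u′ (WLe⇒≤W v≤u′) (WLe⇒≤W u′≤w)))
      where
      -- The Boolean lattice consists of subsets of positions in `ts`, so that its rank is
      -- `length ts`.
      t : Fin (length ts) → Fin n
      t = List.lookup ts
      sel : Subset (length ts) → List (Fin n)
      sel S = map t (elems S)
      ∈-sel⁺ : ∀ {S j} → j ∈ S → t j ∈ₗ sel S
      ∈-sel⁺ j∈S = ∈-map⁺ t (∈-elems⁺ j∈S)
      ∈-sel⁻ : ∀ {S j} → t j ∈ₗ sel S → j ∈ S
      ∈-sel⁻ {S} h with k , k∈ , eq ← ∈-map⁻ t h =
        subst (_∈ S) (sym (lookup-injectiveₗ (letters-unique c) eq)) (∈-elems⁻ k∈)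
      sel⊆ts : ∀ S {i} → i ∈ₗ sel S → i ∈ₗ ts
      sel⊆ts S h with k , _ , refl ← ∈-map⁻ t h = ∈-lookup k
      sel-unique : ∀ S → Unique (sel S)
      sel-unique S = map⁺ (lookup-injectiveₗ (letters-unique c)) (elems-unique S)
      sel-commuting : ∀ S → Commuting v (sel S)
      sel-commuting S = commuting-⊆ (sel-unique S) (sel⊆ts S) c

      dsc? : ∀ u j → Dec (Dsc u (t j))
      dsc? u j = toℕ (lookup u (hi (t j))) <? toℕ (lookup u (lo (t j)))
      -- `f` has to be total on permutations, so it records descents of `u` among the letters of
      -- `ts` and requires no word for `u`.
      f : Perm (2 * n) → Subset (length ts)
      f u = subsetOf (dsc? u)
      g : Subset (length ts) → Perm (2 * n)
      g S = v · wordPerm n (sel S)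

      v≤ : ∀ {us} → Commuting v us → v ≤W (v · wordPerm n us)
      v≤ {us} cu = ≤W-intro us v∈W (M-commuting us v∈W cu)
      v≤w : v ≤W (v · wordPerm n ts)
      v≤w = v≤ c
      g-in : ∀ S → InInterval n v (v · wordPerm n ts) (g S)
      g-in S = ≤W⇒WLe (v≤ (sel-commuting S)) , ≤W⇒WLe (commuting-≤W⁺ c (sel-unique S) (sel⊆ts S))

      detect : ∀ {us} → Unique us → (∀ {i} → i ∈ₗ us → i ∈ₗ ts) → ∀ j → j ∈ f (v · wordPerm n us) → t j ∈ₗ us
      detect {us} u us⊆ts j j∈ with t j ∈ₗ? us
      ... | yes h = h
      ... | no  h = contradiction (∈-subsetOf⁻ (dsc? (v · wordPerm n us)) j∈)
                      (<-asym (commuting-asc c us⊆ts (∈-lookup j) h))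
      detect⁺ : ∀ {us} → Unique us → (∀ {i} → i ∈ₗ us → i ∈ₗ ts) → ∀ j → t j ∈ₗ us → j ∈ f (v · wordPerm n us)
      detect⁺ {us} u us⊆ts j h = ∈-subsetOf⁺ (dsc? (v · wordPerm n us)) (commuting-dsc (commuting-⊆ u us⊆ts c) h)

      f∘g : ∀ S → f (g S) ≡ S
      f∘g S = ⊆-antisym (λ {j} j∈ → ∈-sel⁻ (detect (sel-unique S) (sel⊆ts S) j j∈))
                        (λ {j} j∈ → detect⁺ (sel-unique S) (sel⊆ts S) j (∈-sel⁺ j∈))

      g∘f : ∀ u → v ≤W u → u ≤W (v · wordPerm n ts) → g (f u) ≡ u
      g∘f u v≤u u≤w with us , uus , us⊆ts , refl ← between c v≤u u≤w =
        cong (v ·_) (commuting-cong (commuting-⊆ uus us⊆ts c) (sel-unique _) into onto)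
        where
        into : ∀ {i} → i ∈ₗ sel (f (v · wordPerm n us)) → i ∈ₗ us
        into h with j , j∈ , refl ← ∈-map⁻ t h = detect uus us⊆ts j (∈-elems⁻ j∈)
        onto : ∀ {i} → i ∈ₗ us → i ∈ₗ sel (f (v · wordPerm n us))
        onto {i} h = subst (_∈ₗ sel (f (v · wordPerm n us))) (sym i≡)
          (∈-sel⁺ (detect⁺ uus us⊆ts (index (us⊆ts h)) (subst (_∈ₗ us) i≡ h)))
          where
          i≡ : i ≡ t (index (us⊆ts h))
          i≡ = lookup-index (us⊆ts h)

      order : ∀ u u′ → g (f u) ≡ u → g (f u′) ≡ u′ → (WLe n u u′ → f u ⊆ f u′) × (f u ⊆ f u′ → WLe n u u′)
      order u u′ eq eq′ =
        (λ le j∈ → ∈-sel⁻ (commuting-≤W⁻ (sel-commuting (f u)) (sel-commuting (f u′))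
          (subst₂ _≤W_ (sym eq) (sym eq′) (WLe⇒≤W le)) (∈-sel⁺ j∈))) ,
        (λ fu⊆fu′ → ≤W⇒WLe (subst₂ _≤W_ eq eq′ (commuting-≤W⁺ (sel-commuting (f u′)) (sel-unique (f u))
          (λ h → let j , j∈ , e = ∈-map⁻ t h in subst (_∈ₗ sel (f u′)) (sym e) (∈-sel⁺ (fu⊆fu′ (∈-elems⁻ j∈)))))))

  -- Boolean intervals

  -- A reduced word read backwards spells the inverse with equally many letters. Passing to inverses
  -- lets `M-asc`, which concerns right multiplication, speak about multiplication on the left.
  M-reverse-≤ : ∀ ws → M (wordPerm n (reverse ws)) ≤ M (wordPerm n ws)
  M-reverse-≤ ws with us , us≡ , Mus ← reduced {wordPerm n ws} (ws , refl) = begin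
    M (wordPerm n (reverse ws))     ≡⟨ cong M inverse ⟨
    M (wordPerm n (reverse us))     ≤⟨ wordPerm-M-≤ (reverse us) ⟩
    length (reverse us) * 2         ≡⟨ cong (_* 2) (length-reverse us) ⟩
    length us * 2                   ≡⟨ Mus ⟨
    M (wordPerm n ws)               ∎
    where
    open ≤-Reasoning
    inverse : wordPerm n (reverse us) ≡ wordPerm n (reverse ws)
    inverse = ·-cancelˡ (us , refl) (trans (wordPerm-reverseʳ us)
      (trans (sym (wordPerm-reverseʳ ws)) (cong (_· wordPerm n (reverse ws)) (sym us≡))))

  M-reverse : ∀ ws → M (wordPerm n (reverse ws)) ≡ M (wordPerm n ws)
  M-reverse ws = ≤-antisym (M-reverse-≤ ws)
    (subst (λ us → M (wordPerm n us) ≤ M (wordPerm n (reverse ws))) (reverse-involutive ws) (M-reverse-≤ (reverse ws)))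

  -- The inverse also has a word without `t`, so it preserves {0, ..., t} and the complement. Hence
  -- its entries at `lo t` and `hi t` ascend.
  M-∉ : ∀ t ws → t ∉ₗ ws → M (wordPerm n (t ∷ ws)) ≡ 2 + M (wordPerm n ws)
  M-∉ t ws t∉ = begin
    M (wordPerm n (t ∷ ws))                     ≡⟨ M-reverse (t ∷ ws) ⟨
    M (wordPerm n (reverse (t ∷ ws)))           ≡⟨ cong (M ∘ wordPerm n) (unfold-reverse t ws) ⟩
    M (wordPerm n (reverse ws ++ t ∷ []))       ≡⟨ cong M (wordPerm-++ (reverse ws) (t ∷ [])) ⟩
    M (wordPerm n (reverse ws) · wordPerm n (t ∷ []))  ≡⟨ cong (λ g → M (wordPerm n (reverse ws) · g)) wordPerm-[ t ] ⟩
    M (wordPerm n (reverse ws) · gen n t)       ≡⟨ M-asc (wordPerm n (reverse ws)) t (inW-symmetric (reverse ws , refl)) asc ⟩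
    2 + M (wordPerm n (reverse ws))             ≡⟨ cong (2 +_) (M-reverse ws) ⟩
    2 + M (wordPerm n ws)                       ∎
    where
    open ≡-Reasoning
    t∉′ : t ∉ₗ reverse ws
    t∉′ = t∉ ∘ reverse⁻
    asc : Asc (wordPerm n (reverse ws)) t
    asc = ≤-<-trans (avoid-≤ (reverse ws) t∉′ (lo t) (≤-reflexive (toℕ-lo t)))
                    (avoid-> (reverse ws) t∉′ (hi t) (≤-reflexive (sym (toℕ-hi t))))

  -- If `t` were missing from `ws`, then `zs`, which represents the product of `t ∷ ws`, would be
  -- longer than `ws` by `M-∉`.
  left-descent-∈ : ∀ t zs ws → wordPerm n (t ∷ zs) ≡ wordPerm n ws →
                   M (wordPerm n zs) < M (wordPerm n ws) → t ∈ₗ ws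
  left-descent-∈ t zs ws eq lt with t ∈ₗ? ws
  ... | yes t∈ = t∈
  ... | no  t∉ = contradiction lt (≤⇒≯ (≤-trans (m≤n+m _ 2) (≤-reflexive (sym M-zs))))
    where
    zs≡ : wordPerm n (t ∷ ws) ≡ wordPerm n zs
    zs≡ = trans (cong (gen n t ·_) (sym eq)) (trans (sym (·-assoc (gen n t) (gen n t) (wordPerm n zs)))
      (trans (cong (_· wordPerm n zs) (gen-involutive t)) (·-identityˡ (wordPerm n zs))))
    M-zs : M (wordPerm n zs) ≡ 2 + M (wordPerm n ws)
    M-zs = trans (cong M (sym zs≡)) (M-∉ t ws t∉)

  -- With A = {p ≤ i} ⊆ B = {p ≤ i + 1} (0-indexed positions), the first factorisation puts i + 1 into
  -- the image of A, while the second excludes it from the image of B.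
  no-adjacent : ∀ {i j : Fin n} {zs zs′} → toℕ j ≡ suc (toℕ i) → i ∉ₗ zs → j ∉ₗ zs′ →
                wordPerm n (i ∷ zs) ≢ wordPerm n (j ∷ zs′)
  no-adjacent {i} {j} {zs} {zs′} adj i∉ j∉ eq with p , p≤i , image ← once-image [] zs i∉ =
    contradiction (avoid-≤ zs′ j∉ p (≤-trans p≤i (≤-trans (n≤1+n _) (≤-reflexive (sym adj)))))
      (<⇒≱ (subst (λ q → toℕ j < toℕ q) (sym z′p) (≤-reflexive (sym (toℕ-hi j)))))
    where
    open ≡-Reasoning
    z′p : lookup (wordPerm n zs′) p ≡ hi j
    z′p = begin
      lookup (wordPerm n zs′) p               ≡⟨ σ-involutive j _ ⟨
      σ j (σ j (lookup (wordPerm n zs′) p))   ≡⟨ cong (σ j) (lookup-· (gen n j) (wordPerm n zs′) p) ⟨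
      σ j (lookup (wordPerm n (j ∷ zs′)) p)   ≡⟨ cong (λ x → σ j (lookup x p)) eq ⟨
      σ j (lookup (wordPerm n (i ∷ zs)) p)    ≡⟨ cong (σ j) (trans image (lookup-allFin (hi i))) ⟩
      σ j (hi i)                              ≡⟨ cong (σ j) (toℕ-injective (trans (toℕ-hi i) (sym (trans (toℕ-lo j) adj)))) ⟩
      σ j (lo j)                              ≡⟨ σ-lo≡hi j ⟩
      hi j                                    ∎

  IndependentAscents : Perm (2 * n) → Subset n → Set
  IndependentAscents v T = (∀ {i} → i ∈ T → Asc v i) × Independent T

  independentAscents⇒commuting : ∀ {v T} → IndependentAscents v T → Commuting v (elems T)
  independentAscents⇒commuting {T = T} (asc , ind) = record
    { letters-unique = elems-unique T ; letters-far = independent-far ind ; letters-asc = asc ∘ ∈-elems⁻ }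

  -- Chains and atoms of a Boolean interval

  module _ {v w} (v∈W : InW n v) (v≤w : v ≤W w) {m}
           (f : Perm (2 * n) → Subset m) (g : Subset m → Perm (2 * n))
           (g-in : ∀ S → InInterval n v w (g S))
           (f∘g : ∀ S → f (g S) ≡ S)
           (order : ∀ u u′ → InInterval n v w u → InInterval n v w u′ →
                    (WLe n u u′ → f u ⊆ f u′) × (f u ⊆ f u′ → WLe n u u′)) where

    Within : Perm (2 * n) → Set
    Within u = v ≤W u × u ≤W w

    f-mono : ∀ {u u′} → Within u → Within u′ → u ≤W u′ → f u ⊆ f u′
    f-mono (a , b) (c , d) u≤u′ =
      proj₁ (order _ _ (≤W⇒WLe a , ≤W⇒WLe b) (≤W⇒WLe c , ≤W⇒WLe d)) (≤W⇒WLe u≤u′)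

    f-cancel : ∀ {u u′} → Within u → Within u′ → f u ⊆ f u′ → u ≤W u′
    f-cancel (a , b) (c , d) sub =
      WLe⇒≤W (proj₂ (order _ _ (≤W⇒WLe a , ≤W⇒WLe b) (≤W⇒WLe c , ≤W⇒WLe d)) sub)

    g-within : ∀ S → Within (g S)
    g-within S = WLe⇒≤W (proj₁ (g-in S)) , WLe⇒≤W (proj₂ (g-in S))

    v-within : Within v
    v-within = subst (v ≤W_) (·-identityʳ v) (≤W-intro [] v∈W (trans (cong M (·-identityʳ v)) (sym (+-identityʳ (M v))))) , v≤w

    fv⊆⊥ : f v ⊆ ⊥
    fv⊆⊥ = subst (f v ⊆_) (f∘g ⊥) (f-mono v-within (g-within ⊥) (proj₁ (g-within ⊥)))

    -- Along a geodesic from v to w the images under f strictly increase, so ℓ(v⁻¹w) ≤ m.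
    chain-bound : ∀ us ws → v · wordPerm n (us ++ ws) ≡ w → M w ≡ M v + length (us ++ ws) * 2 →
                  ∣ f (v · wordPerm n us) ∣ + length ws ≤ m
    chain-bound us []       _  _  = ≤-trans (≤-reflexive (+-identityʳ _)) (∣p∣≤n (f (v · wordPerm n us)))
    chain-bound us (t ∷ ws) w≡ Mw = begin
      ∣ f (v · wordPerm n us) ∣ + suc (length ws)   ≡⟨ +-suc _ (length ws) ⟩
      suc ∣ f (v · wordPerm n us) ∣ + length ws     ≤⟨ +-monoˡ-≤ (length ws) (∣∣-strict-mono fu⊆fu′ fu′⊈fu) ⟩
      ∣ f u′ ∣ + length ws                          ≤⟨ chain-bound us′ ws w≡′ Mw′ ⟩
      m                                             ∎
      where
      open ≤-Reasoning
      us′ = us ++ t ∷ []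
      u u′ : Perm (2 * n)
      u = v · wordPerm n us
      u′ = v · wordPerm n us′
      regroup : us ++ t ∷ ws ≡ us′ ++ ws
      regroup = sym (++-assoc us (t ∷ []) ws)
      w≡′ : v · wordPerm n (us′ ++ ws) ≡ w
      w≡′ = subst (λ xs → v · wordPerm n xs ≡ w) regroup w≡
      Mw′ : M w ≡ M v + length (us′ ++ ws) * 2
      Mw′ = subst (λ xs → M w ≡ M v + length xs * 2) regroup Mw
      M-u′ : M u′ ≡ M v + length us′ * 2
      M-u′ = proj₁ (geodesic us′ ws v∈W (trans (cong M w≡′) Mw′))
      u-within : Within u
      u-within with a , b ← geodesic-≤W us (t ∷ ws) v∈W (trans (cong M w≡) Mw) = a , subst (u ≤W_) w≡ b
      u′-within : Within u′
      u′-within with a , b ← geodesic-≤W us′ ws v∈W (trans (cong M w≡′) Mw′) = a , subst (u′ ≤W_) w≡′ b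
      M-step : M u′ ≡ M u + 2
      M-step = trans (cong M (·-++ v us (t ∷ []))) (proj₂ (geodesic us (t ∷ []) v∈W M-u′))
      fu⊆fu′ : f u ⊆ f u′
      fu⊆fu′ = f-mono u-within u′-within (proj₂ (geodesic-≤W us (t ∷ []) v∈W M-u′))
      -- `f` reflects the order, so an inclusion would give `u′ ≤W u` although `M` has grown by 2.
      fu′⊈fu : ¬ f u′ ⊆ f u
      fu′⊈fu sub = <⇒≱ (m<m+n (M u) (s≤s z≤n)) (≤-trans (≤-reflexive (sym M-step)) (M-mono (f-cancel u′-within u-within sub)))

    record Atom (j : Fin m) : Set where
      field
        letter   : Fin n
        M-letter : M (v · wordPerm n (letter ∷ [])) ≡ M v + 2
        within   : Within (v · wordPerm n (letter ∷ []))
        ∋j       : j ∈ f (v · wordPerm n (letter ∷ []))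
        only-j   : f (v · wordPerm n (letter ∷ [])) ⊆ ⁅ j ⁆
    open Atom

    -- The first letter of a reduced word from v to g ⁅ j ⁆ already leaves f v = ⊥.
    atom : ∀ j → Atom j
    atom j with g ⁅ j ⁆ in g≡ | proj₁ (g-within ⁅ j ⁆)
    ... | _ | mk _ y∈W refl Ma with ys , refl , My ← reduced y∈W | ys
    ...   | [] = contradiction (fv⊆⊥ (subst (j ∈_) (sym fv≡) (x∈⁅x⁆ j))) ∉⊥
      where
      fv≡ : f v ≡ ⁅ j ⁆
      fv≡ = trans (cong f (trans (sym (·-identityʳ v)) (sym g≡))) (f∘g ⁅ j ⁆)
    ...   | t ∷ ys′ = record { letter = t ; M-letter = Mu ; within = u-within ; ∋j = j∈ ; only-j = fu⊆ }
      where
      u = v · wordPerm n (t ∷ [])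
      Ma′ = trans Ma (cong (M v +_) My)
      Mu : M u ≡ M v + 2
      Mu = proj₁ (geodesic (t ∷ []) ys′ v∈W Ma′)
      steps = geodesic-≤W (t ∷ []) ys′ v∈W Ma′
      u≤g : u ≤W g ⁅ j ⁆
      u≤g = subst (u ≤W_) (sym g≡) (proj₂ steps)
      u-within : Within u
      u-within = proj₁ steps , ≤W-trans u≤g (proj₂ (g-within ⁅ j ⁆))
      fu⊆ : f u ⊆ ⁅ j ⁆
      fu⊆ = subst (f u ⊆_) (f∘g ⁅ j ⁆) (f-mono u-within (g-within ⁅ j ⁆) u≤g)
      fu⊈fv : ¬ f u ⊆ f v
      fu⊈fv sub = <⇒≱ (m<m+n (M v) (s≤s z≤n)) (≤-trans (≤-reflexive (sym Mu)) (M-mono (f-cancel u-within v-within sub)))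
      -- A subset of the singleton that misses `j` is empty, and would then be contained in `f v`.
      j∈ : j ∈ f u
      j∈ with j ∈? f u
      ... | yes h = h
      ... | no  h = contradiction (λ {k} k∈ → contradiction (subst (_∈ f u) (x∈⁅y⁆⇒x≡y j (fu⊆ k∈)) k∈) h) fu⊈fv

    t : Fin m → Fin n
    t j = letter (atom j)

    t-injective : ∀ {j j′} → t j ≡ t j′ → j ≡ j′
    t-injective {j} {j′} eq = x∈⁅y⁆⇒x≡y j′ (only-j (atom j′)
      (subst (λ s → j ∈ f (v · wordPerm n (s ∷ []))) eq (∋j (atom j))))

    t-asc : ∀ j → Asc v (t j)
    t-asc j with asc? v (t j)
    ... | yes asc = asc
    ... | no ¬asc = contradiction (≤-reflexive (sym M-up)) (<⇒≱ (≤-<-trans M-down (m<m+n (M v) (s≤s z≤n))))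
      where
      M-up : M (v · gen n (t j)) ≡ M v + 2
      M-up = trans (cong (λ x → M (v · x)) (sym wordPerm-[ t j ])) (M-letter (atom j))
      M-down : M (v · gen n (t j)) ≤ M v
      M-down = ≤-trans (m≤n+m _ 2) (≤-reflexive (sym (M-dsc v (t j) (inW-symmetric v∈W) (¬asc⇒dsc v∈W (t j) ¬asc))))

    module _ xs (w≡ : v · wordPerm n xs ≡ w) (Mw : M w ≡ M v + length xs * 2) (Mx : M (wordPerm n xs) ≡ length xs * 2) where

      -- Since `w` lies above the atom v·t_j, a reduced word of the remaining quotient completes
      -- `t j` to a word of the length of `xs`.
      starts-with : ∀ j → ∃ λ zs → wordPerm n (t j ∷ zs) ≡ wordPerm n xs × length (t j ∷ zs) ≡ length xs
      starts-with j with mk _ z∈W eq Mw′ ← proj₂ (within (atom j)) with zs , refl , Mz ← reduced z∈W =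
        zs , ·-cancelˡ v∈W (trans (·-++ v (t j ∷ []) zs) (trans eq (sym w≡))) ,
        *-cancelʳ-≡ _ _ 2 (+-cancelˡ-≡ (M v) _ _ (begin
          M v + (2 + length zs * 2)                                  ≡⟨ +-assoc (M v) 2 _ ⟨
          M v + 2 + length zs * 2                                    ≡⟨ cong₂ _+_ (M-letter (atom j)) Mz ⟨
          M (v · wordPerm n (t j ∷ [])) + M (wordPerm n zs)          ≡⟨ Mw′ ⟨
          M w                                                        ≡⟨ Mw ⟩
          M v + length xs * 2                                        ∎))
        where open ≡-Reasoning

      ts : List (Fin n)
      ts = List.tabulate t

      ts⊆xs : ∀ {i} → i ∈ₗ ts → i ∈ₗ xs
      ts⊆xs i∈ with j , refl ← ∈-tabulate⁻ {f = t} i∈ with zs , eq , len-eq ← starts-with j =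
        left-descent-∈ (t j) zs xs eq (begin-strict
          M (wordPerm n zs)        ≤⟨ wordPerm-M-≤ zs ⟩
          length zs * 2            <⟨ *-monoˡ-< 2 (≤-reflexive len-eq) ⟩
          length xs * 2            ≡⟨ Mx ⟨
          M (wordPerm n xs)        ∎)
        where open ≤-Reasoning

      -- `chain-bound` with the empty prefix gives `length xs ≤ m`, which is the number of letters
      -- in `ts`.
      xs↭ts : xs ↭ ts
      xs↭ts = ⊆-length⇒↭ (tabulate⁺ t-injective) ts⊆xs (≤-trans
        (≤-trans (m≤n+m (length xs) _) (chain-bound [] xs w≡ Mw)) (≤-reflexive (sym (length-tabulate t))))

      xs-unique : Unique xs
      xs-unique = unique-↭ (↭-sym xs↭ts) (tabulate⁺ t-injective)

      -- The word from `starts-with` is a rearrangement of `xs`, so it repeats no letter. This is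
      -- the form in which `no-adjacent` compares two initial letters.
      avoiding-tail : ∀ {i} → i ∈ₗ xs → ∃ λ zs → wordPerm n (i ∷ zs) ≡ wordPerm n xs × i ∉ₗ zs
      avoiding-tail i∈ with j , refl ← ∈-tabulate⁻ {f = t} (∈-resp-↭ xs↭ts i∈) with zs , eq , len-eq ← starts-with j =
        zs , eq , Unique[x∷xs]⇒x∉xs (unique-↭ (↭-sym (shortest-↭ xs-unique eq (≤-reflexive len-eq))) xs-unique)

      letters : Subset n
      letters = subsetOf (_∈ₗ? xs)

      letters-independentAscents : IndependentAscents v letters
      letters-independentAscents = asc , ind
        where
        asc : ∀ {i} → i ∈ letters → Asc v i
        asc i∈ with j , refl ← ∈-tabulate⁻ {f = t} (∈-resp-↭ xs↭ts (∈-subsetOf⁻ (_∈ₗ? xs) i∈)) = t-asc j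
        ind : Independent letters
        ind i∈ j∈ adj
          with zs , eq , i∉ ← avoiding-tail (∈-subsetOf⁻ (_∈ₗ? xs) i∈)
             | zs′ , eq′ , j∉ ← avoiding-tail (∈-subsetOf⁻ (_∈ₗ? xs) j∈) =
          no-adjacent adj i∉ j∉ (trans eq (sym eq′))

      w≡letters : w ≡ v · wordPerm n (elems letters)
      w≡letters = trans (sym w≡) (cong (v ·_) (commuting-cong (independentAscents⇒commuting {v} letters-independentAscents) xs-unique
        (∈-elems⁺ ∘ ∈-subsetOf⁺ (_∈ₗ? xs)) (∈-subsetOf⁻ (_∈ₗ? xs) ∘ ∈-elems⁻)))

  boolean⇒independentAscents : ∀ {v w} → InW n v → IsBooleanInterval n v w →
                               ∃ λ T → IndependentAscents v T × w ≡ v · wordPerm n (elems T)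
  boolean⇒independentAscents {v} v∈W (v≤w , m , f , g , g-in , f∘g , _ , order)
    with v≤w′@(mk _ x∈W w≡ Mw) ← WLe⇒≤W v≤w with xs , refl , Mx ← reduced x∈W =
    letters v∈W v≤w′ f g g-in f∘g order xs w≡ Mw′ Mx ,
    letters-independentAscents v∈W v≤w′ f g g-in f∘g order xs w≡ Mw′ Mx ,
    w≡letters v∈W v≤w′ f g g-in f∘g order xs w≡ Mw′ Mx
    where
    Mw′ = trans Mw (cong (M v +_) Mx)

  -- A letter `i` in only one of the sets tells the products apart: one moves a position out of {0,
  -- ..., i}, the other preserves this segment.
  elems-product-injective : ∀ {T T′ : Subset n} → wordPerm n (elems T) ≡ wordPerm n (elems T′) → T ≡ T′
  elems-product-injective {T} {T′} eq = ⊆-antisym (one eq) (one (sym eq))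
    where
    one : ∀ {T T′ : Subset n} → wordPerm n (elems T) ≡ wordPerm n (elems T′) → T ⊆ T′
    one {T} {T′} eq {i} i∈T with i ∈? T′
    ... | yes i∈T′ = i∈T′
    ... | no  i∉T′ with us , ws , e , i∉us , i∉ws ← unique-split (elems-unique T) (∈-elems⁺ i∈T)
                   with p , p≤i , i<p ← once-moves us ws i∉us i∉ws =
      contradiction (subst (λ x → toℕ (lookup x p) ≤ toℕ i) (trans (sym eq) (cong (wordPerm n) e))
        (avoid-≤ (elems T′) (i∉T′ ∘ ∈-elems⁻) p p≤i)) (<⇒≱ i<p)

theorem3p6 : (n : ℕ) → 2 ≤ n → (v : Perm (2 * n)) → InW n v →
    (k : ℕ) (bs : Vec (Subset n) k) → IsComponents n (λ i → ¬ Des n v i) k bs →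
    Σ (List (Perm (2 * n))) λ ws →
    Unique ws ×
    (∀ w → (w ∈ₗ ws → InW n w × IsBooleanInterval n v w) ×
    (InW n w × IsBooleanInterval n v w → w ∈ₗ ws)) ×
    length ws ≡ prodFib bs
theorem3p6 n _ v v∈W k bs (cover , disjoint , ⊆A , rest) =
  map top (indep false ascents) ,
  map⁺ (elems-product-injective ∘ ·-cancelˡ v∈W) (indep-unique false ascents) ,
  (λ w → to w , from w) ,
  -- The given components are those of the non-descents. They are carried over to the decidable set
  -- of one-line ascents, which has the same members.
  trans (length-map top (indep false ascents)) (#indep-components bs ascents
    ( (λ i i∈ → cover i (asc⇒¬Des v∈W i (∈-subsetOf⁻ (asc? v) i∈)))
    , disjoint
    , (λ j i i∈ → ∈-subsetOf⁺ (asc? v) (¬Des⇒asc v∈W i (⊆A j i i∈)))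
    , rest))
  where
  open TypeC n
  top : Subset n → Perm (2 * n)
  top T = v · wordPerm n (elems T)
  ascents : Subset n
  ascents = subsetOf (asc? v)
  to : ∀ w → w ∈ₗ map top (indep false ascents) → InW n w × IsBooleanInterval n v w
  to w w∈ with T , T∈ , refl ← ∈-map⁻ top w∈ with T⊆ , ind , _ ← ∈-indep⁻ false T∈ =
    inW-word (elems T) v∈W ,
    commuting⇒boolean v∈W (independentAscents⇒commuting ((∈-subsetOf⁻ (asc? v) ∘ T⊆) , ind))
  from : ∀ w → InW n w × IsBooleanInterval n v w → w ∈ₗ map top (indep false ascents)
  from w (_ , boolean) with T , (asc , ind) , refl ← boolean⇒independentAscents v∈W boolean =
    ∈-map⁺ top (∈-indep⁺ false (∈-subsetOf⁺ (asc? v) ∘ asc) ind λ ())
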